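{- Let $\mathcal C\subseteq\mathcal L_{n,q}$ be an $\mathbb F_{q^n}$-linear MRD code of dimension $k>2$. Then $\mathcal C$ is equivalent to a generalized twisted Gabidulin code if and only if there exists an integer $s$ with $\gcd(s,n)=1$ such that the following two conditions hold: (1) $\dim(\mathcal C\cap\mathcal C^{[s]})=k-2$ and $\dim(\mathcal C\cap\mathcal C^{[s]}\cap\mathcal C^{[2s]})=k-3$; that is, there exist $p(x),q(x)\in\mathcal L_{n,q}$, with $q(x)\in\mathcal C$, such that \[\mathcal C=\langle p(x)^{[s]},p(x)^{[2s]},\ldots,p(x)^{[s(k-1)]}\rangle_{\mathbb F_{q^n}}\oplus\langle q(x)\rangle_{\mathbb F_{q^n}};\] (2) $p(x)$ is invertible and there exists $\eta\in\mathbb F_{q^n}^*$ with $\mathrm N_{q^n/q}(\eta)\neq(-1)^{kn}$ such that $p(x)+\eta\,p(x)^{[sk]}\in\mathcal C$.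
   Context: $q$ is a prime power, $[i]:=q^i$. $\mathcal L_{n,q}$ is the $\mathbb F_{q^n}$-vector space of linearized polynomials $f(x)=\sum_{i=0}^{n-1}a_ix^{[i]}$, $a_i\in\mathbb F_{q^n}$, identified with $\mathbb F_q$-linear maps of $\mathbb F_{q^n}$. For $f(x)=\sum_i a_ix^{[i]}$, $f(x)^{[j]}:=x^{[j]}\circ f(x)=\sum_i a_i^{[j]}x^{[(i+j)\bmod n]}$, and $\mathcal C^{[j]}=\{f^{[j]}\colon f\in\mathcal C\}$. A code (an $\mathbb F_q$-subspace of $\mathcal L_{n,q}$ with rank distance $\mathrm{rk}(f-g)$, minimum distance $d$) is MRD if $|\mathcal C|=q^{n(n-d+1)}$. $\mathrm N_{q^n/q}(\eta)=\prod_{i=0}^{n-1}\eta^{[i]}$. A generalized twisted Gabidulin code is any code equivalent to $\mathcal H_{k,s}(\eta)=\langle x+\eta x^{[sk]},x^{[s]},\ldots,x^{[s(k-1)]}\rangle_{\mathbb F_{q^n}}$ with $\gcd(s,n)=1$, $\eta\neq0$, $\mathrm N_{q^n/q}(\eta)\neq(-1)^{nk}$. Codes $\mathcal C,\mathcal C'$ are equivalent if there are invertible $h,g\in\mathcal L_{n,q}$ and a field automorphism $\sigma$ (acting on coefficients) with $\{h\circ f^\sigma\circ g\colon f\in\mathcal C\}=\mathcal C'$.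
   Formalization: The formal theorem adds k ≤ n−2: for k ≥ n−1 one has dim(C∩C^[s]) ≥ k−1 for every s, so condition (1) never holds, while for q > 2 the code H_{k,s}(η) itself (e.g. n=4, k=3, q=3) is a twisted Gabidulin MRD code, so the statement as written fails. -}

module Defs where

open import Level using (0ℓ)
open import Algebra.Bundles using (CommutativeRing)
open import Algebra.Bundles.Raw using (RawRing)
open import Algebra.Structures using (IsCommutativeRing)
open import Algebra.Module.Bundles.Raw using (RawLeftModule)
open import Algebra.Morphism.Structures using (module RingMorphisms)
import Algebra.Definitions.RawMonoid as RawMonoidDefs
import Algebra.Definitions.RawSemiring as RawSemiringDefs
open import Data.Fin.Base using (Fin; zero; suc; toℕ)
open import Data.Nat.Base as ℕ using (ℕ; NonZero; _≤_; _∸_)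
open import Data.Nat.DivMod using (_%_)
open import Data.Nat.GCD using (gcd)
open import Data.Nat.Properties using (_≟_)
open import Data.Nat.Primality using (Prime)
open import Data.Product.Base using (∃; ∃-syntax; _×_)
open import Data.Vec.Base using (Vec; lookup; map; replicate; tabulate; zipWith)
open import Function.Bundles using (_↔_)
open import Function.Definitions using (Injective)
open import Relation.Binary.PropositionalEquality.Core using (_≡_; _≢_)
open import Relation.Nullary.Decidable.Core using (does)
open import Relation.Unary using (Pred; U; _∈_; _≐_)
open import Data.Bool.Base using (if_then_else_)

IsPrimePower : ℕ → Set
IsPrimePower q = ∃[ p ] ∃[ e ] Prime p × 1 ≤ e × q ≡ p ℕ.^ e

record FiniteField (N : ℕ) : Set₁ where
  infix  8 -_
  infixl 7 _*_
  infixl 6 _+_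
  field
    Carrier           : Set
    _+_ _*_           : Carrier → Carrier → Carrier
    -_                : Carrier → Carrier
    0# 1#             : Carrier
    isCommutativeRing : IsCommutativeRing _≡_ _+_ _*_ -_ 0# 1#
    0≢1               : 0# ≢ 1#
    invertible        : ∀ x → x ≢ 0# → ∃[ y ] x * y ≡ 1#
    enumeration       : Carrier ↔ Fin N

  commutativeRing : CommutativeRing 0ℓ 0ℓ
  commutativeRing = record { isCommutativeRing = isCommutativeRing }

  open CommutativeRing commutativeRing public using (rawRing)
  open RawRing rawRing public using (rawSemiring)
  open RawSemiringDefs rawSemiring public using (_^_; sum; product)

-- Linear algebra over a subfield K of a ring of scalars S; K is given as a
-- predicate on S, so that one S-module can be viewed over S or over K.
module LinearAlgebra {S : Set} (0S : S) (M : RawLeftModule S 0ℓ 0ℓ) where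
  open RawLeftModule M
  open RawMonoidDefs +ᴹ-rawMonoid using () renaming (sum to sumᴹ)

  combination : ∀ {d} → (Fin d → S) → (Fin d → Carrierᴹ) → Carrierᴹ
  combination c b = sumᴹ (λ i → c i *ₗ b i)

  Span : ∀ {d} → Pred S 0ℓ → (Fin d → Carrierᴹ) → Pred Carrierᴹ 0ℓ
  Span K b v = ∃[ c ] (∀ i → c i ∈ K) × v ≈ᴹ combination c b

  LinearlyIndependent : ∀ {d} → Pred S 0ℓ → (Fin d → Carrierᴹ) → Set
  LinearlyIndependent K b =
    ∀ c → (∀ i → c i ∈ K) → combination c b ≈ᴹ 0ᴹ → ∀ i → c i ≡ 0S

  HasDim : Pred S 0ℓ → Pred Carrierᴹ 0ℓ → ℕ → Set
  HasDim K V d =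
    ∃[ b ] LinearlyIndependent {d} K b × V ≐ Span K b

  record IsSubspace (K : Pred S 0ℓ) (V : Pred Carrierᴹ 0ℓ) : Set where
    field
      0-closed : 0ᴹ ∈ V
      +-closed : ∀ {u v} → u ∈ V → v ∈ V → u +ᴹ v ∈ V
      *-closed : ∀ {a v} → a ∈ K → v ∈ V → a *ₗ v ∈ V

  record IsDirectSum (V A B : Pred Carrierᴹ 0ℓ) : Set where
    field
      sum-≐        : V ≐ (λ v → ∃[ a ] ∃[ b ] a ∈ A × b ∈ B × v ≈ᴹ a +ᴹ b)
      intersection : ∀ v → v ∈ A → v ∈ B → v ≈ᴹ 0ᴹ

module RankMetric (q n : ℕ) .{{_ : NonZero n}} (F : FiniteField (q ℕ.^ n)) where
  open FiniteField F public

  infixl 9 _^[_]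
  _^[_] : Carrier → ℕ → Carrier
  a ^[ i ] = a ^ (q ℕ.^ i)

  -- The subfield with q elements, as the set of roots of X^q - X.
  𝔽q : Pred Carrier 0ℓ
  𝔽q a = a ^ q ≡ a

  norm : Carrier → Carrier
  norm η = product {n} (λ i → η ^[ toℕ i ])

  fieldModule : RawLeftModule Carrier 0ℓ 0ℓ
  fieldModule = record
    { Carrierᴹ = Carrier ; _≈ᴹ_ = _≡_ ; _+ᴹ_ = _+_ ; _*ₗ_ = _*_ ; 0ᴹ = 0# ; -ᴹ_ = -_ }

  -- The vector (a₀, …, aₙ₋₁) stands for the linearized polynomial Σ aᵢ x^[i].
  𝓛 : Set
  𝓛 = Vec Carrier n

  𝓛-module : RawLeftModule Carrier 0ℓ 0ℓ
  𝓛-module = record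
    { Carrierᴹ = 𝓛
    ; _≈ᴹ_     = _≡_
    ; _+ᴹ_     = zipWith _+_
    ; _*ₗ_     = λ a → map (a *_)
    ; 0ᴹ       = replicate n 0#
    ; -ᴹ_      = map (-_)
    }

  open RawLeftModule 𝓛-module public using (_+ᴹ_; _*ₗ_; 0ᴹ; -ᴹ_)
  open RawMonoidDefs (RawLeftModule.+ᴹ-rawMonoid 𝓛-module) public
    using () renaming (sum to sumᴹ)
  open LinearAlgebra 0# 𝓛-module public

  eval : 𝓛 → Carrier → Carrier
  eval f x = sum (λ i → lookup f i * x ^[ toℕ i ])

  -- a x^[i], with the exponent reduced modulo n because x^[n] = x as a map.
  monomial : Carrier → ℕ → 𝓛
  monomial a i = tabulate (λ m → if does (toℕ m ≟ i % n) then a else 0#)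

  x^[_] : ℕ → 𝓛
  x^[ i ] = monomial 1# i

  -- Composition of linearized polynomials:
  -- (Σ aᵢ x^[i]) ∘ (Σ bⱼ x^[j]) = Σᵢⱼ aᵢ bⱼ^[i] x^[i+j].
  infixr 9 _∘ᴸ_
  _∘ᴸ_ : 𝓛 → 𝓛 → 𝓛
  f ∘ᴸ g = sumᴹ (λ i → sumᴹ (λ j →
    monomial (lookup f i * lookup g j ^[ toℕ i ]) (toℕ i ℕ.+ toℕ j)))

  Invertible : 𝓛 → Set
  Invertible f = ∃[ g ] f ∘ᴸ g ≡ x^[ 0 ] × g ∘ᴸ f ≡ x^[ 0 ]

  infixl 9 _^ᴸ[_]
  _^ᴸ[_] : 𝓛 → ℕ → 𝓛
  f ^ᴸ[ j ] = x^[ j ] ∘ᴸ f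

  infixl 9 _^ᶜ[_]
  _^ᶜ[_] : Pred 𝓛 0ℓ → ℕ → Pred 𝓛 0ℓ
  (C ^ᶜ[ j ]) g = ∃[ f ] f ∈ C × g ≡ f ^ᴸ[ j ]

  HasRank : 𝓛 → ℕ → Set
  HasRank f r = LinearAlgebra.HasDim 0# fieldModule 𝔽q (λ y → ∃[ x ] y ≡ eval f x) r

  HasMinDistance : Pred 𝓛 0ℓ → ℕ → Set
  HasMinDistance C d =
      (∃[ f ] ∃[ g ] f ∈ C × g ∈ C × f ≢ g × HasRank (f +ᴹ (-ᴹ g)) d)
    × (∀ f g r → f ∈ C → g ∈ C → f ≢ g → HasRank (f +ᴹ (-ᴹ g)) r → d ≤ r)

  HasCardinality : Pred 𝓛 0ℓ → ℕ → Set
  HasCardinality C N =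
    ∃[ e ] Injective {A = Fin N} _≡_ _≡_ e × C ≐ (λ f → ∃[ i ] f ≡ e i)

  IsMRD : Pred 𝓛 0ℓ → Set
  IsMRD C = IsSubspace 𝔽q C ×
    (∃[ d ] HasMinDistance C d × HasCardinality C (q ℕ.^ (n ℕ.* (n ∸ d ℕ.+ 1))))

  IsFieldAutomorphism : (Carrier → Carrier) → Set
  IsFieldAutomorphism = RingMorphisms.IsRingIsomorphism rawRing rawRing

  Equivalent : Pred 𝓛 0ℓ → Pred 𝓛 0ℓ → Set
  Equivalent C D = ∃[ h ] ∃[ g ] ∃[ σ ]
    Invertible h × Invertible g × IsFieldAutomorphism σ ×
    (λ φ → ∃[ f ] f ∈ C × φ ≡ h ∘ᴸ map σ f ∘ᴸ g) ≐ D

  -- x + η x^[sk], x^[s], …, x^[s(k-1)].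
  𝓗-generators : ∀ k → ℕ → Carrier → Fin k → 𝓛
  𝓗-generators k s η zero    = x^[ 0 ] +ᴹ (η *ₗ x^[ s ℕ.* k ])
  𝓗-generators k s η (suc i) = x^[ s ℕ.* toℕ (suc i) ]

  𝓗 : ℕ → ℕ → Carrier → Pred 𝓛 0ℓ
  𝓗 k s η = Span U (𝓗-generators k s η)

  AdmissibleNorm : ℕ → Carrier → Set
  AdmissibleNorm k η = norm η ≢ (- 1#) ^ (n ℕ.* k)

  IsGTGabidulin : Pred 𝓛 0ℓ → Set
  IsGTGabidulin D = ∃[ k ] ∃[ s ] ∃[ η ]
    1 ≤ k × k ≤ n × gcd s n ≡ 1 × η ≢ 0# × AdmissibleNorm k η ×
    Equivalent D (𝓗 k s η)

  -- p^[s], p^[2s], …, p^[s(k-1)].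
  powers : 𝓛 → ℕ → ∀ k → Fin (k ∸ 1) → 𝓛
  powers p s k i = p ^ᴸ[ s ℕ.* ℕ.suc (toℕ i) ]

{-# OPTIONS --safe #-}

-- Let C be equivalent to 𝓗 through f ↦ h ∘ f^σ ∘ g. For 2 < k ≤ n - 2 the left
-- idealiser of 𝓗 = 𝓗_{k,s}(η) consists of the scalars only, so h a h⁻¹ is a
-- scalar for every scalar a; as distinct powers of the Frobenius automorphism
-- are distinct maps, h has a single term c x^[i]. Absorbing h and σ into η and
-- g turns C into 𝓗_{k,s}(η′) ∘ p with p invertible. In terms of the
-- coefficients aᵢ of x^[si], 𝓗_{k,s}(η′) is given by a_k = η′ a₀ and aᵢ = 0 for
-- k < i < n, and the intersections with its shifts by s and 2s are spanned by
-- the x^[si] with 2 ≤ i < k and with 3 ≤ i < k. Conversely, p + η p^[sk] is not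
-- a combination of the p^[si] with 0 < i < k, so the decomposition of C forces
-- C = 𝓗_{k,s}(η) ∘ p.

module Submission where

open import Defs
open import Level using (0ℓ)
open import Algebra.Bundles using (CommutativeRing; CommutativeMonoid)
import Algebra.Morphism.Construct.Identity as Identity
open import Algebra.Morphism.Structures using (module RingMorphisms)
import Algebra.Properties.CommutativeMonoid.Sum as MonoidSum
import Algebra.Properties.CommutativeSemiring.Binomial as Binomial
import Algebra.Properties.CommutativeSemiring.Exp as SemiringExp
import Algebra.Properties.Ring as RingProperties
import Algebra.Properties.Semiring.Mult as SemiringMult
open import Data.Bool.Base using (if_then_else_)
open import Data.Fin.Base as Fin using (Fin; zero; suc; toℕ; fromℕ; inject₁)
import Data.Fin.Permutation as Permutation
import Data.Fin.Properties as Fin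
open import Data.Nat.Base as ℕ using (ℕ; zero; suc; NonZero; _<_; _≤_; _∸_; z≤n; s≤s; _!)
import Data.Nat.Combinatorics as Combinatorics
open import Data.Nat.Combinatorics using (nCn≡1; nCk≡n!/k![n-k]!; k![n∸k]!∣n!)
open import Data.Nat.Coprimality using (coprime-Bézout; gcd≡1⇒coprime)
open import Data.Nat.Divisibility using (_∣_; divides; ∣⇒≤; m∣m*n)
open import Data.Nat.DivMod
  using (_%_; _/_; _mod_; m/n*n≡m; m%n<n; m%n%n≡m%n; m<n⇒m%n≡m; m≡m%n+[m/n]*n;
         [m+kn]%n≡m%n; %-distribˡ-+; %-distribˡ-*)
open import Data.Nat.GCD using (gcd; module Bézout)
open import Data.Nat.Primality using (Prime; euclidsLemma; prime⇒nonZero; prime⇒nonTrivial)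
import Data.Nat.Properties as ℕ
open import Data.Product.Base using (∃-syntax; _×_; _,_; proj₁; proj₂)
open import Data.Sum.Base using (inj₁; inj₂)
open import Data.Vec.Base using (lookup; map)
import Data.Vec.Properties as Vec
open import Function.Base using (_∘_; id; case_of_)
open import Function.Bundles using (_⇔_; mk⇔; Inverse; mk↔ₛ′)
open import Function.Definitions using (Injective)
open import Function.Properties.Inverse using (↔⇒↣)
open import Relation.Binary.Definitions using (DecidableEquality; tri<; tri≈; tri>)
open import Relation.Binary.PropositionalEquality
open import Relation.Binary.PropositionalEquality.Algebra using (isMagma)
open import Relation.Nullary using (¬_; yes; no; does; contradiction)
open import Relation.Nullary.Decidable using (via-injection; dec-true; dec-false; ¬?)
open import Relation.Unary using (Pred; U; _∈_; _∩_)

open ≡-Reasoning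

-- Monomiality of `h` rests on the bounds `2 < k` and `k ≤ n - 2` for the parameter of the twisted
-- Gabidulin code, and that parameter `k′` is not given to equal the dimension `k` of `C`. It has to
-- be identified while `f ↦ h ∘ f^σ ∘ g` is known only to be an additive bijection, which need not
-- respect scalars of the large field. Linear algebra cannot carry dimensions across such a map;
-- counting the points of finite spaces can. The idealiser is found by sweeping. Composing `u` with
-- `x^[sj]`, `0 < j < k`, moves its coefficients by `j` places, and the positions strictly between
-- `k` and `n` must stay empty. This kills everything in `u` except the places 0, 1 and `n - 1`; the
-- last two fall to the equation `a_k = η a₀`, which ties them to places already known to vanish.
-- For the intersections, positions run past `n` and wrap around. A zero interval that starts at `k`
-- then ends beyond `n`, and each further shift pushes its end by one: the shifted twist equation
-- turns a known zero at `k + j` into a zero at `j`.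

-- Binomial coefficients modulo a prime

m∣m! : ∀ m .{{_ : NonZero m}} → m ∣ m !
m∣m! (suc m) = m∣m*n (m !)

module _ {p : ℕ} (p-prime : Prime p) where

  private instance
    _ = prime⇒nonZero p-prime

  prime∤! : ∀ m → m < p → ¬ (p ∣ m !)
  prime∤! zero m<p p∣1 =
    ℕ.<⇒≱ (ℕ.nonTrivial⇒n>1 p {{prime⇒nonTrivial p-prime}}) (∣⇒≤ p∣1)
  prime∤! (suc m) m<p p∣ with euclidsLemma (suc m) (m !) p-prime p∣
  ... | inj₁ p∣1+m = ℕ.<⇒≱ m<p (∣⇒≤ p∣1+m)
  ... | inj₂ p∣m!  = prime∤! m (ℕ.<-trans (ℕ.n<1+n m) m<p) p∣m!

  -- `p` divides `p !`, which is the binomial coefficient times `k ! * (p ∸ k) !`. Both factorials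
  -- belong to numbers below `p`, so neither can absorb the prime.
  prime∣binomial : ∀ k → 0 < k → k < p → p ∣ p Combinatorics.C k
  prime∣binomial k 0<k k<p with euclidsLemma (p Combinatorics.C k) (k ! ℕ.* (p ∸ k) !) p-prime p∣
    where
    instance _ = k ℕ.!* (p ∸ k) !≢0
    p∣ : p ∣ (p Combinatorics.C k) ℕ.* (k ! ℕ.* (p ∸ k) !)
    p∣ rewrite nCk≡n!/k![n-k]! (ℕ.<⇒≤ k<p) | m/n*n≡m (k![n∸k]!∣n! (ℕ.<⇒≤ k<p)) = m∣m! p
  ... | inj₁ p∣C = p∣C
  ... | inj₂ p∣d with euclidsLemma (k !) ((p ∸ k) !) p-prime p∣d
  ...   | inj₁ p∣k! = contradiction p∣k! (prime∤! k k<p)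
  ...   | inj₂ p∣r! = contradiction p∣r!
                        (prime∤! (p ∸ k) (ℕ.∸-monoʳ-< 0<k (ℕ.<⇒≤ k<p)))

-- Sums with at most one nontrivial term

module MonoidSumProperties (M : CommutativeMonoid 0ℓ 0ℓ) where
  open CommutativeMonoid M renaming (trans to ≈-trans)
  open MonoidSum M public

  sum-ε : ∀ {m} (t : Fin m → Carrier) → (∀ i → t i ≈ ε) → sum t ≈ ε
  sum-ε {m} t t≈ε = ≈-trans (sum-cong-≋ t≈ε) (sum-replicate-zero m)

  sum-single : ∀ {m} (t : Fin m → Carrier) i → (∀ j → j ≢ i → t j ≈ ε) → sum t ≈ t i
  sum-single t zero    t≈ε =
    ≈-trans (∙-congˡ (sum-ε (t ∘ suc) (λ j → t≈ε (suc j) λ ()))) (identityʳ _)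
  sum-single t (suc i) t≈ε =
    ≈-trans (∙-cong (t≈ε zero λ ())
                    (sum-single (t ∘ suc) i (λ j j≢i → t≈ε (suc j) (j≢i ∘ Fin.suc-injective))))
            (identityˡ _)

-- Finite fields: Fermat, characteristic, roots of polynomials

module FiniteFieldProperties {N : ℕ} (F : FiniteField N) where
  open FiniteField F
  open CommutativeRing commutativeRing public
    using ( +-assoc; +-comm; +-identityˡ; +-identityʳ; -‿inverseˡ; -‿inverseʳ
          ; *-assoc; *-comm; *-identityˡ; *-identityʳ; zeroˡ; zeroʳ; distribˡ; distribʳ
          ; +-commutativeMonoid; *-commutativeMonoid; commutativeSemiring; semiring; ring
          ; _-_)
  open RingProperties ring public
    using (-‿distribʳ-*; +-cancelˡ; +-cancelʳ)
  open SemiringExp commutativeSemiring public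
    using (^-homo-*; ^-assocʳ; ^-distrib-*)
  open Inverse enumeration renaming (to to index; from to element)

  module ∑ = MonoidSumProperties +-commutativeMonoid
  module ∏ = MonoidSumProperties *-commutativeMonoid
  open SemiringMult semiring using (×-assocˡ; ×-assoc-*; ×1-homo-*; ×-homo-1)
    renaming (_×_ to infixr 8 _·_)

  infix 4 _≟ᶠ_
  abstract
    _≟ᶠ_ : DecidableEquality Carrier
    _≟ᶠ_ = via-injection (↔⇒↣ enumeration) Fin._≟_

  x*y≡0⇒y≡0 : ∀ {x y} → x ≢ 0# → x * y ≡ 0# → y ≡ 0#
  x*y≡0⇒y≡0 {x} {y} x≢0 xy≡0 with invertible x x≢0
  ... | z , xz≡1 = begin
    y           ≡⟨ *-identityˡ y ⟨
    1# * y      ≡⟨ cong (_* y) (trans (*-comm z x) xz≡1) ⟨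
    z * x * y   ≡⟨ *-assoc z x y ⟩
    z * (x * y) ≡⟨ cong (z *_) xy≡0 ⟩
    z * 0#      ≡⟨ zeroʳ z ⟩
    0#          ∎

  *-nonZero : ∀ {x y} → x ≢ 0# → y ≢ 0# → x * y ≢ 0#
  *-nonZero x≢0 y≢0 = y≢0 ∘ x*y≡0⇒y≡0 x≢0

  ^-nonZero : ∀ {x} m → x ≢ 0# → x ^ m ≢ 0#
  ^-nonZero zero    x≢0 = 0≢1 ∘ sym
  ^-nonZero (suc m) x≢0 = *-nonZero x≢0 (^-nonZero m x≢0)

  x-y≡0⇒x≡y : ∀ {x y} → x - y ≡ 0# → x ≡ y
  x-y≡0⇒x≡y {x} {y} eq = +-cancelʳ (- y) x y (trans eq (sym (-‿inverseʳ y)))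

  *-cancelˡ-nonZero : ∀ x {y z} → x ≢ 0# → x * y ≡ x * z → y ≡ z
  *-cancelˡ-nonZero x {y} {z} x≢0 eq = x-y≡0⇒x≡y (x*y≡0⇒y≡0 x≢0 (begin
    x * (y - z)         ≡⟨ distribˡ x y (- z) ⟩
    x * y + x * - z     ≡⟨ cong₂ _+_ eq (sym (-‿distribʳ-* x z)) ⟩
    x * z - x * z       ≡⟨ -‿inverseʳ _ ⟩
    0#                  ∎))

  ^-zeroˡ : ∀ m → 0 < m → 0# ^ m ≡ 0#
  ^-zeroˡ (suc m) _ = zeroˡ _

  ^-oneˡ : ∀ m → 1# ^ m ≡ 1#
  ^-oneˡ zero    = refl
  ^-oneˡ (suc m) = trans (*-identityˡ _) (^-oneˡ m)

  N>0 : 0 < N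
  N>0 = ℕ.≤-trans (s≤s z≤n) (Fin.toℕ<n (index 0#))

  private
    reindex : (f g : Carrier → Carrier) → (∀ x → f (g x) ≡ x) → (∀ x → g (f x) ≡ x) →
              Permutation.Permutation N N
    reindex f g fg gf = mk↔ₛ′ (index ∘ f ∘ element) (index ∘ g ∘ element)
      (λ i → trans (cong (index ∘ f) (strictlyInverseʳ _)) (trans (cong index (fg _)) (strictlyInverseˡ i)))
      (λ i → trans (cong (index ∘ g) (strictlyInverseʳ _)) (trans (cong index (gf _)) (strictlyInverseˡ i)))

  -- Translation by 1 permutes the field, so the sum of all elements is unchanged when `N` ones are
  -- added to it.
  N·1≡0 : N · 1# ≡ 0#
  N·1≡0 = +-cancelˡ (sum element) _ _ (begin
    sum element + N · 1#                   ≡⟨ cong (sum element +_) (∑.sum-replicate N) ⟨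
    sum element + sum {N} (λ _ → 1#)       ≡⟨ ∑.∑-distrib-+ element (λ _ → 1#) ⟨
    sum (λ i → element i + 1#)             ≡⟨ ∑.sum-cong-≗ (λ i → strictlyInverseʳ (element i + 1#)) ⟨
    sum (λ i → element (index (element i + 1#)))
      ≡⟨ ∑.sum-permute element (reindex (_+ 1#) (_- 1#)
           (λ x → trans (+-assoc x _ _) (trans (cong (x +_) (-‿inverseˡ 1#)) (+-identityʳ x)))
           (λ x → trans (+-assoc x _ _) (trans (cong (x +_) (-‿inverseʳ 1#)) (+-identityʳ x)))) ⟨
    sum element                            ≡⟨ +-identityʳ _ ⟨
    sum element + 0#                       ∎)

  product-nonZero : ∀ {m} (t : Fin m → Carrier) → (∀ i → t i ≢ 0#) → product t ≢ 0#
  product-nonZero {zero}  t t≢0 = 0≢1 ∘ sym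
  product-nonZero {suc m} t t≢0 = *-nonZero (t≢0 zero) (product-nonZero (t ∘ suc) (t≢0 ∘ suc))

  -- Multiplication by x ≠ 0 permutes the nonzero elements; the element 0 is
  -- replaced by 1 in the product, and the correction factor restores x ^ N.
  fermat : ∀ x → x ^ N ≡ x
  fermat x with x ≟ᶠ 0#
  ... | yes refl = ^-zeroˡ N N>0
  ... | no x≢0 with invertible x x≢0
  ...   | x⁻¹ , xx⁻¹≡1 = sym (*-cancelˡ-nonZero (product unit) P≢0 (begin
    product unit * x                       ≡⟨ cong₂ _*_ P≡ (sym W≡) ⟩
    product shifted * product correction   ≡⟨ ∏.∑-distrib-+ shifted correction ⟨
    product (λ i → shifted i * correction i) ≡⟨ ∏.sum-cong-≗ (λ i → combine (element i)) ⟩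
    product (λ i → unit i * x)             ≡⟨ ∏.∑-distrib-+ unit (λ _ → x) ⟩
    product unit * product {N} (λ _ → x)   ≡⟨ cong (product unit *_) (∏.sum-replicate N) ⟩
    product unit * x ^ N                   ∎))
    where
    nz w : Carrier → Carrier
    nz y = if does (y ≟ᶠ 0#) then 1# else y
    w y = if does (y ≟ᶠ 0#) then x else 1#
    unit shifted correction : Fin N → Carrier
    unit i = nz (element i)
    shifted i = nz (x * element i)
    correction i = w (element i)
    nz≢0 : ∀ y → nz y ≢ 0#
    nz≢0 y with y ≟ᶠ 0#
    ... | yes _  = 0≢1 ∘ sym
    ... | no y≢0 = y≢0
    P≢0 : product unit ≢ 0#
    P≢0 = product-nonZero unit (nz≢0 ∘ element)
    combine : ∀ y → nz (x * y) * w y ≡ nz y * x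
    combine y with y ≟ᶠ 0#
    ... | yes refl rewrite dec-true (x * 0# ≟ᶠ 0#) (zeroʳ x) = refl
    ... | no y≢0 rewrite dec-false (x * y ≟ᶠ 0#) (*-nonZero x≢0 y≢0) =
      trans (*-identityʳ _) (*-comm x y)
    W≡ : product correction ≡ x
    W≡ = trans (∏.sum-single correction (index 0#) other) at0
      where
      at0 : correction (index 0#) ≡ x
      at0 rewrite strictlyInverseʳ 0# | dec-true (0# ≟ᶠ 0#) refl = refl
      other : ∀ j → j ≢ index 0# → correction j ≡ 1#
      other j j≢ rewrite dec-false (element j ≟ᶠ 0#)
        (λ eq → j≢ (trans (sym (strictlyInverseˡ j)) (cong index eq))) = refl
    P≡ : product unit ≡ product shifted
    P≡ = begin
      product unit
        ≡⟨ ∏.sum-permute unit (reindex (x *_) (x⁻¹ *_) inv inv′) ⟩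
      product (λ i → unit (index (x * element i)))
        ≡⟨ ∏.sum-cong-≗ (λ i → cong nz (strictlyInverseʳ (x * element i))) ⟩
      product shifted ∎
      where
      inv : ∀ y → x * (x⁻¹ * y) ≡ y
      inv y = trans (sym (*-assoc x x⁻¹ y)) (trans (cong (_* y) xx⁻¹≡1) (*-identityˡ y))
      inv′ : ∀ y → x⁻¹ * (x * y) ≡ y
      inv′ y = trans (sym (*-assoc x⁻¹ x y))
        (trans (cong (_* y) (trans (*-comm x⁻¹ x) xx⁻¹≡1)) (*-identityˡ y))

  module _ {p m : ℕ} (p-prime : Prime p) (N≡p^m : N ≡ p ℕ.^ m) where

    -- The power `(p · 1#) ^ m` equals `N · 1#`, which vanishes, and a field has no nonzero
    -- nilpotent element.
    p·1≡0 : p · 1# ≡ 0#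
    p·1≡0 with p · 1# ≟ᶠ 0#
    ... | yes eq  = eq
    ... | no p1≢0 = contradiction
      (trans (sym (power m)) (trans (cong (_· 1#) (sym N≡p^m)) N·1≡0)) (^-nonZero m p1≢0)
      where
      power : ∀ j → (p ℕ.^ j) · 1# ≡ (p · 1#) ^ j
      power zero    = ×-homo-1 1#
      power (suc j) = trans (×1-homo-* p (p ℕ.^ j)) (cong (p · 1# *_) (power j))

    p∣j⇒j·x≡0 : ∀ {j} x → p ∣ j → j · x ≡ 0#
    p∣j⇒j·x≡0 x (divides c refl) = begin
      (c ℕ.* p) · x     ≡⟨ cong (_· x) (ℕ.*-comm c p) ⟩
      (p ℕ.* c) · x     ≡⟨ ×-assocˡ x p c ⟨
      p · (c · x)       ≡⟨ cong (p ·_) (*-identityˡ _) ⟨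
      p · (1# * c · x)  ≡⟨ ×-assoc-* p 1# _ ⟨
      (p · 1#) * c · x  ≡⟨ cong (_* c · x) p·1≡0 ⟩
      0# * c · x        ≡⟨ zeroˡ _ ⟩
      0#                ∎

    ^p-distrib-+ : ∀ x y → (x + y) ^ p ≡ x ^ p + y ^ p
    ^p-distrib-+ x y = trans (theorem p x y) (lemma p p-prime refl)
      where
      open Binomial commutativeSemiring
      -- The exponent is generalised from `p` to `j` so that it can be matched as a successor; only
      -- then do the first and last binomial terms split off.
      lemma : ∀ j → Prime j → j ≡ p → binomialExpansion x y j ≡ x ^ j + y ^ j
      lemma zero j-prime = contradiction refl (ℕ.≢-nonZero⁻¹ 0 {{prime⇒nonZero j-prime}})
      lemma (suc j) _ refl = begin
        term zero + sum (λ i → term (suc i))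
          ≡⟨ cong (term zero +_) (∑.sum-init-last (λ i → term (suc i))) ⟩
        term zero + (sum (λ i → term (suc (inject₁ i))) + term (suc (fromℕ j)))
          ≡⟨ cong (λ z → term zero + (z + term (suc (fromℕ j)))) (∑.sum-ε _ middle) ⟩
        term zero + (0# + term (suc (fromℕ j)))
          ≡⟨ cong₂ _+_ first (trans (+-identityˡ _) last) ⟩
        y ^ suc j + x ^ suc j
          ≡⟨ +-comm _ _ ⟩
        x ^ suc j + y ^ suc j ∎
        where
        term : Fin (suc (suc j)) → Carrier
        term = binomialTerm x y (suc j)
        middle : ∀ i → term (suc (inject₁ i)) ≡ 0#
        middle i = p∣j⇒j·x≡0 _ (prime∣binomial p-prime _ (s≤s z≤n)
          (s≤s (subst (_< j) (sym (Fin.toℕ-inject₁ i)) (Fin.toℕ<n i))))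
        first : term zero ≡ y ^ suc j
        first = trans (+-identityʳ _) (*-identityˡ _)
        last : term (suc (fromℕ j)) ≡ x ^ suc j
        last rewrite Fin.toℕ-fromℕ j | nCn≡1 (suc j) | ℕ.n∸n≡0 j =
          trans (+-identityʳ _) (*-identityʳ _)

    ^p^-distrib-+ : ∀ e x y → (x + y) ^ (p ℕ.^ e) ≡ x ^ (p ℕ.^ e) + y ^ (p ℕ.^ e)
    ^p^-distrib-+ zero    x y =
      trans (*-identityʳ _) (sym (cong₂ _+_ (*-identityʳ x) (*-identityʳ y)))
    ^p^-distrib-+ (suc e) x y = begin
      (x + y) ^ (p ℕ.* p ℕ.^ e)                     ≡⟨ ^-assocʳ (x + y) p _ ⟨
      ((x + y) ^ p) ^ (p ℕ.^ e)                     ≡⟨ cong (_^ (p ℕ.^ e)) (^p-distrib-+ x y) ⟩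
      (x ^ p + y ^ p) ^ (p ℕ.^ e)                   ≡⟨ ^p^-distrib-+ e (x ^ p) (y ^ p) ⟩
      (x ^ p) ^ (p ℕ.^ e) + (y ^ p) ^ (p ℕ.^ e)     ≡⟨ cong₂ _+_ (^-assocʳ x p _) (^-assocʳ y p _) ⟩
      x ^ (p ℕ.* p ℕ.^ e) + y ^ (p ℕ.* p ℕ.^ e)     ∎

  -- Polynomial functions are described through their Horner form.
  Monic : ℕ → (Carrier → Carrier) → Set
  Monic zero    f = ∀ x → f x ≡ 1#
  Monic (suc d) f = ∃[ g ] ∃[ c ] Monic d g × (∀ x → f x ≡ x * g x + c)

  -- Synthetic division: the value at `r` of the inner Horner stage is the constant term of the
  -- quotient, and the value of the outermost stage is the remainder.
  monic-divide : ∀ d {f} → Monic (suc d) f → ∀ r →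
                 ∃[ g ] Monic d g × (∀ x → f x ≡ (x - r) * g x + f r)
  monic-divide zero {f} (g , c , g≡1 , f≡) r = (λ _ → 1#) , (λ _ → refl) , λ x → begin
    f x                       ≡⟨ f-lin x ⟩
    x + c                     ≡⟨ cong (_+ c) (+-identityʳ x) ⟨
    x + 0# + c                ≡⟨ cong (λ z → x + z + c) (-‿inverseˡ r) ⟨
    x + (- r + r) + c         ≡⟨ cong (_+ c) (+-assoc x (- r) r) ⟨
    x - r + r + c             ≡⟨ +-assoc (x - r) r c ⟩
    x - r + (r + c)           ≡⟨ cong₂ _+_ (*-identityʳ _) (f-lin r) ⟨
    (x - r) * 1# + f r        ∎
    where
    f-lin : ∀ x → f x ≡ x + c
    f-lin x = trans (f≡ x) (cong (_+ c) (trans (cong (x *_) (g≡1 x)) (*-identityʳ x)))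
  monic-divide (suc d) {f} (g , c , g-monic , f≡) r with monic-divide d g-monic r
  ... | g′ , g′-monic , g≡ =
    (λ x → x * g′ x + g r) , (g′ , g r , g′-monic , λ _ → refl) , λ x → begin
    f x                                             ≡⟨ f≡ x ⟩
    x * g x + c                                     ≡⟨ cong (λ z → x * z + c) (g≡ x) ⟩
    x * ((x - r) * g′ x + g r) + c                  ≡⟨ cong (_+ c) (distribˡ x _ _) ⟩
    x * ((x - r) * g′ x) + x * g r + c              ≡⟨ cong (λ z → z + x * g r + c) (swap x) ⟩
    (x - r) * (x * g′ x) + x * g r + c
      ≡⟨ cong (λ z → (x - r) * (x * g′ x) + z * g r + c) (split x) ⟩
    (x - r) * (x * g′ x) + (x - r + r) * g r + c
      ≡⟨ cong (λ z → (x - r) * (x * g′ x) + z + c) (distribʳ (g r) (x - r) r) ⟩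
    (x - r) * (x * g′ x) + ((x - r) * g r + r * g r) + c
      ≡⟨ cong (_+ c) (+-assoc _ _ _) ⟨
    (x - r) * (x * g′ x) + (x - r) * g r + r * g r + c
      ≡⟨ +-assoc _ _ c ⟩
    (x - r) * (x * g′ x) + (x - r) * g r + (r * g r + c)
      ≡⟨ cong₂ _+_ (distribˡ (x - r) _ _) (f≡ r) ⟨
    (x - r) * (x * g′ x + g r) + f r                ∎
    where
    split : ∀ x → x ≡ x - r + r
    split x = sym (trans (+-assoc x (- r) r) (trans (cong (x +_) (-‿inverseˡ r)) (+-identityʳ x)))
    swap : ∀ x → x * ((x - r) * g′ x) ≡ (x - r) * (x * g′ x)
    swap x = trans (sym (*-assoc x (x - r) _))
      (trans (cong (_* g′ x) (*-comm x (x - r))) (*-assoc (x - r) x _))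

  -- Split off the first root. By injectivity the linear factor is nonzero at the other roots, so
  -- these are roots of the quotient, whose degree is smaller by one.
  monic-roots : ∀ d {f} → Monic d f → ∀ {m} (r : Fin m → Carrier) → Injective _≡_ _≡_ r →
                (∀ i → f (r i) ≡ 0#) → m ≤ d
  monic-roots d       _       {zero}  r r-inj root = z≤n
  monic-roots zero    f≡1     {suc m} r r-inj root =
    contradiction (trans (sym (root zero)) (f≡1 _)) 0≢1
  monic-roots (suc d) f-monic {suc m} r r-inj root with monic-divide d f-monic (r zero)
  ... | g , g-monic , f≡ = s≤s (monic-roots d g-monic (r ∘ suc) (Fin.suc-injective ∘ r-inj)
    λ i → x*y≡0⇒y≡0
      (λ eq → case r-inj (x-y≡0⇒x≡y eq) of λ ())
      (trans (sym (+-identityʳ _)) (trans (cong (_ +_) (sym (root zero)))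
        (trans (sym (f≡ (r (suc i)))) (root (suc i))))))

  monic-^ : ∀ d → Monic d (_^ d)
  monic-^ zero    x = refl
  monic-^ (suc d)   = (_^ d) , 0# , monic-^ d , λ x → sym (+-identityʳ _)

  monic-x^m*[x^d-c] : ∀ d m c → Monic (m ℕ.+ suc d) (λ x → x ^ m * (x ^ suc d - c))
  monic-x^m*[x^d-c] d zero    c = (_^ d) , - c , monic-^ d , λ x → *-identityˡ _
  monic-x^m*[x^d-c] d (suc m) c = _ , 0# , monic-x^m*[x^d-c] d m c ,
    λ x → trans (*-assoc x (x ^ m) _) (sym (+-identityʳ _))

  -- Otherwise all `N` elements would be roots of `x ^ i * (x ^ (j ∸ i) - 1#)`, which is monic of
  -- degree `j < N`.
  ^-distinct : ∀ {i j} → i < j → j < N → ¬ (∀ x → x ^ i ≡ x ^ j)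
  ^-distinct {i} {j} i<j j<N eq = ℕ.<⇒≱ j<N (subst (N ≤_) i+1+d≡j
    (monic-roots (i ℕ.+ suc d) (monic-x^m*[x^d-c] d i 1#) element
      (λ {a} {b} e → trans (sym (strictlyInverseˡ a)) (trans (cong index e) (strictlyInverseˡ b)))
      (root ∘ element)))
    where
    d : ℕ
    d = j ∸ suc i
    i+1+d≡j : i ℕ.+ suc d ≡ j
    i+1+d≡j = trans (ℕ.+-suc i d) (ℕ.m+[n∸m]≡n i<j)
    root : ∀ x → x ^ i * (x ^ suc d - 1#) ≡ 0#
    root x = begin
      x ^ i * (x ^ suc d - 1#)             ≡⟨ distribˡ (x ^ i) _ _ ⟩
      x ^ i * x ^ suc d + x ^ i * - 1#
        ≡⟨ cong₂ _+_ (^-homo-* x i (suc d)) (-‿distribʳ-* (x ^ i) 1#) ⟨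
      x ^ (i ℕ.+ suc d) - x ^ i * 1#
        ≡⟨ cong₂ (λ a b → x ^ a - b) i+1+d≡j (trans (*-identityʳ _) (eq x)) ⟩
      x ^ j - x ^ j                        ≡⟨ -‿inverseʳ _ ⟩
      0#                                   ∎

-- Congruence of indices modulo `n`

module Congruence (n : ℕ) .{{_ : NonZero n}} where

  infix 4 _≋_
  _≋_ : ℕ → ℕ → Set
  i ≋ j = i % n ≡ j % n

  %-≋ : ∀ i → i % n ≋ i
  %-≋ i = m%n%n≡m%n i n

  ≋-+ : ∀ {i i′ j j′} → i ≋ i′ → j ≋ j′ → i ℕ.+ j ≋ i′ ℕ.+ j′
  ≋-+ {i} {i′} {j} {j′} p q = trans (%-distribˡ-+ i j n)
    (trans (cong₂ (λ a b → (a ℕ.+ b) % n) p q) (sym (%-distribˡ-+ i′ j′ n)))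

  ≋-* : ∀ {i i′ j j′} → i ≋ i′ → j ≋ j′ → i ℕ.* j ≋ i′ ℕ.* j′
  ≋-* {i} {i′} {j} {j′} p q = trans (%-distribˡ-* i j n)
    (trans (cong₂ (λ a b → (a ℕ.* b) % n) p q) (sym (%-distribˡ-* i′ j′ n)))

  ≋-+-multiple : ∀ i k → i ℕ.+ k ℕ.* n ≋ i
  ≋-+-multiple i k = [m+kn]%n≡m%n i k n

  k+k*[n-1]≡k*n : ∀ k → k ℕ.+ k ℕ.* (n ∸ 1) ≡ k ℕ.* n
  k+k*[n-1]≡k*n k = trans (sym (ℕ.*-suc k (n ∸ 1)))
    (cong (k ℕ.*_) (ℕ.m+[n∸m]≡n (ℕ.>-nonZero⁻¹ n)))

  -- k (n - 1) serves as the negative of k modulo n.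
  ≋-inverse : ∀ i k → i ℕ.+ k ℕ.+ k ℕ.* (n ∸ 1) ≋ i
  ≋-inverse i k = trans
    (cong (_% n) (trans (ℕ.+-assoc i k _) (cong (i ℕ.+_) (k+k*[n-1]≡k*n k))))
    (≋-+-multiple i k)

  ≋-+-cancelʳ : ∀ {i j} k → i ℕ.+ k ≋ j ℕ.+ k → i ≋ j
  ≋-+-cancelʳ {i} {j} k p = trans (sym (≋-inverse i k))
    (trans (≋-+ {j = k ℕ.* (n ∸ 1)} p refl) (≋-inverse j k))

  ≋-< : ∀ {i j} → i < n → j < n → i ≋ j → i ≡ j
  ≋-< i<n j<n p = trans (sym (m<n⇒m%n≡m i<n)) (trans p (m<n⇒m%n≡m j<n))

  -- The difference `j ∸ i` lies strictly between 0 and `n`. Among `n` consecutive positions this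
  -- separates any two residue classes.
  ≋-window : ∀ {i j} → i < j → j < n ℕ.+ i → ¬ (i ≋ j)
  ≋-window {i} {j} i<j j<n+i p = ℕ.<⇒≢ 0<d
    (≋-< (ℕ.>-nonZero⁻¹ n) d<n (≋-+-cancelʳ i (trans p (cong (_% n) (sym d+i≡j)))))
    where
    d+i≡j : j ∸ i ℕ.+ i ≡ j
    d+i≡j = ℕ.m∸n+n≡m (ℕ.<⇒≤ i<j)
    0<d : 0 < j ∸ i
    0<d = ℕ.m<n⇒0<n∸m i<j
    d<n : j ∸ i < n
    d<n = ℕ.+-cancelʳ-< i _ _ (subst (_< n ℕ.+ i) (sym d+i≡j) j<n+i)

  -- The offset `r` from `a` is `m - a` reduced modulo `n`. Shifted codes are easiest to describe on
  -- a window that starts at `a` instead of 0.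
  representative : ∀ a m → ∃[ i ] a ≤ i × i < n ℕ.+ a × i ≋ m
  representative a m = a ℕ.+ r , ℕ.m≤m+n a r ,
    subst (a ℕ.+ r <_) (ℕ.+-comm a n) (ℕ.+-monoʳ-< a (m%n<n _ n)) ,
    trans (cong (_% n) (ℕ.+-comm a r)) (trans (≋-+ {j = a} (%-≋ (m ℕ.+ a ℕ.* (n ∸ 1))) refl)
      (trans (cong (_% n) (trans (ℕ.+-assoc m _ a) (trans (cong (m ℕ.+_) (ℕ.+-comm _ a)) (sym (ℕ.+-assoc m a _)))))
        (≋-inverse m a)))
    where
    r : ℕ
    r = (m ℕ.+ a ℕ.* (n ∸ 1)) % n

-- The algebra of linearized polynomials

module LinearizedPolynomials (q n : ℕ) .{{_ : NonZero n}} (q-primePower : IsPrimePower q)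
                             (F : FiniteField (q ℕ.^ n)) where
  open RankMetric q n F public
  open FiniteFieldProperties F public
  open Congruence n public

  private
    p e : ℕ
    p = proj₁ q-primePower
    e = proj₁ (proj₂ q-primePower)

    p-prime : Prime p
    p-prime = proj₁ (proj₂ (proj₂ q-primePower))

    q^i≡p^ : ∀ i → q ℕ.^ i ≡ p ℕ.^ (e ℕ.* i)
    q^i≡p^ i = trans (cong (ℕ._^ i) (proj₂ (proj₂ (proj₂ (proj₂ q-primePower))))) (ℕ.^-*-assoc p e i)

  1<q : 1 < q
  1<q = subst (1 <_) (sym (proj₂ (proj₂ (proj₂ (proj₂ q-primePower)))))
    (ℕ.<-≤-trans 1<p (subst (_≤ p ℕ.^ e) (ℕ.^-identityʳ p) (ℕ.^-monoʳ-≤ p 1≤e)))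
    where
    instance _ = prime⇒nonZero p-prime
    1<p : 1 < p
    1<p = ℕ.nonTrivial⇒n>1 p {{prime⇒nonTrivial p-prime}}
    1≤e : 1 ≤ e
    1≤e = proj₁ (proj₂ (proj₂ (proj₂ q-primePower)))

  frobenius-+ : ∀ i x y → (x + y) ^[ i ] ≡ x ^[ i ] + y ^[ i ]
  frobenius-+ i x y rewrite q^i≡p^ i = ^p^-distrib-+ {p} {e ℕ.* n} p-prime (q^i≡p^ n) (e ℕ.* i) x y

  frobenius-* : ∀ i x y → (x * y) ^[ i ] ≡ x ^[ i ] * y ^[ i ]
  frobenius-* i x y = ^-distrib-* x y (q ℕ.^ i)

  frobenius-0 : ∀ i → 0# ^[ i ] ≡ 0#
  frobenius-0 i = ^-zeroˡ (q ℕ.^ i) (ℕ.m^n>0 q {{ℕ.>-nonZero (ℕ.<-trans (s≤s z≤n) 1<q)}} i)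

  frobenius-1 : ∀ i → 1# ^[ i ] ≡ 1#
  frobenius-1 i = ^-oneˡ (q ℕ.^ i)

  frobenius-nonZero : ∀ i {x} → x ≢ 0# → x ^[ i ] ≢ 0#
  frobenius-nonZero i = ^-nonZero (q ℕ.^ i)

  frobenius-zero : ∀ x → x ^[ 0 ] ≡ x
  frobenius-zero = *-identityʳ

  frobenius-frobenius : ∀ i j x → x ^[ i ] ^[ j ] ≡ x ^[ i ℕ.+ j ]
  frobenius-frobenius i j x =
    trans (^-assocʳ x (q ℕ.^ i) (q ℕ.^ j)) (cong (x ^_) (sym (ℕ.^-distribˡ-+-* q i j)))

  frobenius-multiple : ∀ k x → x ^[ k ℕ.* n ] ≡ x
  frobenius-multiple zero    x = frobenius-zero x
  frobenius-multiple (suc k) x = trans (sym (frobenius-frobenius n (k ℕ.* n) x))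
    (trans (frobenius-multiple k _) (fermat x))

  private
    frobenius-% : ∀ i x → x ^[ i % n ] ≡ x ^[ i ]
    frobenius-% i x = trans (sym (frobenius-multiple (i / n) _))
      (trans (frobenius-frobenius (i % n) _ x) (cong (x ^[_]) (sym (m≡m%n+[m/n]*n i n))))

  frobenius-≋ : ∀ {i j} → i ≋ j → ∀ x → x ^[ i ] ≡ x ^[ j ]
  frobenius-≋ {i} {j} p x =
    trans (sym (frobenius-% i x)) (trans (cong (x ^[_]) p) (frobenius-% j x))

  -- For exponents below `n` the powers `q ^ i` stay below the field size `q ^ n`, so the root count
  -- of `^-distinct` applies.
  frobenius-distinct : ∀ {i j} → i < n → j < n → (∀ x → x ^[ i ] ≡ x ^[ j ]) → i ≡ j
  frobenius-distinct {i} {j} i<n j<n eq with ℕ.<-cmp i j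
  ... | tri≈ _ i≡j _ = i≡j
  ... | tri< i<j _ _ = contradiction eq (^-distinct (ℕ.^-monoʳ-< q 1<q i<j) (ℕ.^-monoʳ-< q 1<q j<n))
  ... | tri> _ _ j<i = contradiction (sym ∘ eq)
                         (^-distinct (ℕ.^-monoʳ-< q 1<q j<i) (ℕ.^-monoʳ-< q 1<q i<n))

  toℕ-mod : ∀ i → (toℕ i) mod n ≡ i
  toℕ-mod i = trans (Fin.fromℕ<-cong _ _ (m<n⇒m%n≡m (Fin.toℕ<n i)) (m%n<n _ n) (Fin.toℕ<n i))
    (Fin.fromℕ<-toℕ i (Fin.toℕ<n i))

  abstract
    -- Coefficients are read periodically at every natural number, so that exponents can be added
    -- and shifted without reduction. The lemmas of this abstract block form its interface.
    coef : 𝓛 → ℕ → Carrier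
    coef f m = lookup f (m mod n)

    coef-lookup : ∀ f m → coef f m ≡ lookup f (m mod n)
    coef-lookup f m = refl

    coef-≋ : ∀ f {i j} → i ≋ j → coef f i ≡ coef f j
    coef-≋ f {i} {j} p = cong (lookup f) (Fin.fromℕ<-cong (i % n) (j % n) p (m%n<n i n) (m%n<n j n))

    coef-ext : ∀ {f g} → (∀ m → coef f m ≡ coef g m) → f ≡ g
    coef-ext {f} {g} eq = trans (sym (Vec.tabulate∘lookup f))
      (trans (Vec.tabulate-cong λ i → subst (λ j → lookup f j ≡ lookup g j) (toℕ-mod i) (eq (toℕ i)))
        (Vec.tabulate∘lookup g))

    coef-+ : ∀ f g m → coef (f +ᴹ g) m ≡ coef f m + coef g m
    coef-+ f g m = Vec.lookup-zipWith _+_ (m mod n) f g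

    coef-map : ∀ σ f m → coef (map σ f) m ≡ σ (coef f m)
    coef-map σ f m = Vec.lookup-map (m mod n) σ f

    coef-0 : ∀ m → coef 0ᴹ m ≡ 0#
    coef-0 m = Vec.lookup-replicate (m mod n) 0#

    private
      coef-monomial : ∀ a i m → coef (monomial a i) m ≡ (if does (m % n ℕ.≟ i % n) then a else 0#)
      coef-monomial a i m = trans (Vec.lookup∘tabulate _ (m mod n))
        (cong (λ r → if does (r ℕ.≟ i % n) then a else 0#) (Fin.toℕ-fromℕ< (m%n<n m n)))

    coef-monomial-≋ : ∀ a {i m} → m ≋ i → coef (monomial a i) m ≡ a
    coef-monomial-≋ a {i} {m} p = trans (coef-monomial a i m)
      (cong (λ b → if b then a else 0#) (dec-true (m % n ℕ.≟ i % n) p))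

    coef-monomial-≋̸ : ∀ a {i m} → ¬ (m ≋ i) → coef (monomial a i) m ≡ 0#
    coef-monomial-≋̸ a {i} {m} p = trans (coef-monomial a i m)
      (cong (λ b → if b then a else 0#) (dec-false (m % n ℕ.≟ i % n) p))

  monomial-ext : ∀ a i f → coef f i ≡ a → (∀ m → ¬ (m ≋ i) → coef f m ≡ 0#) → f ≡ monomial a i
  monomial-ext a i f at off = coef-ext λ m → case m % n ℕ.≟ i % n of λ where
    (yes p) → trans (coef-≋ f p) (trans at (sym (coef-monomial-≋ a p)))
    (no ¬p) → trans (off m ¬p) (sym (coef-monomial-≋̸ a ¬p))

  monomial-≋ : ∀ a {i j} → i ≋ j → monomial a i ≡ monomial a j
  monomial-≋ a {i} {j} p = monomial-ext a j _ (coef-monomial-≋ a (sym p))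
    (λ m m≋̸j → coef-monomial-≋̸ a (m≋̸j ∘ λ eq → trans eq p))

  monomial-+ : ∀ a b i → monomial (a + b) i ≡ monomial a i +ᴹ monomial b i
  monomial-+ a b i = sym (monomial-ext (a + b) i _
    (trans (coef-+ _ _ i) (cong₂ _+_ (coef-monomial-≋ a {i} refl) (coef-monomial-≋ b {i} refl)))
    (λ m p → trans (coef-+ _ _ m)
      (trans (cong₂ _+_ (coef-monomial-≋̸ a p) (coef-monomial-≋̸ b p)) (+-identityʳ 0#))))

  monomial-0 : ∀ i → monomial 0# i ≡ 0ᴹ
  monomial-0 i = sym (monomial-ext 0# i _ (coef-0 i) (λ m _ → coef-0 m))

  map-monomial : ∀ σ a i → σ 0# ≡ 0# → map σ (monomial a i) ≡ monomial (σ a) i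
  map-monomial σ a i σ0≡0 = monomial-ext (σ a) i _
    (trans (coef-map σ _ i) (cong σ (coef-monomial-≋ a {i} refl)))
    (λ m p → trans (coef-map σ _ m) (trans (cong σ (coef-monomial-≋̸ a p)) σ0≡0))

  +ᴹ-commutativeMonoid : CommutativeMonoid 0ℓ 0ℓ
  +ᴹ-commutativeMonoid = record
    { Carrier = 𝓛 ; _≈_ = _≡_ ; _∙_ = _+ᴹ_ ; ε = 0ᴹ
    ; isCommutativeMonoid = record
      { isMonoid = record
        { isSemigroup = record
          { isMagma = isMagma _
          ; assoc = Vec.zipWith-assoc +-assoc }
        ; identity = Vec.zipWith-identityˡ +-identityˡ , Vec.zipWith-identityʳ +-identityʳ }
      ; comm = Vec.zipWith-comm +-comm } }

  module ∑ᴹ = MonoidSumProperties +ᴹ-commutativeMonoid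

  +ᴹ-identityˡ : ∀ f → 0ᴹ +ᴹ f ≡ f
  +ᴹ-identityˡ = Vec.zipWith-identityˡ +-identityˡ

  +ᴹ-identityʳ : ∀ f → f +ᴹ 0ᴹ ≡ f
  +ᴹ-identityʳ = Vec.zipWith-identityʳ +-identityʳ

  record Additive (T : 𝓛 → 𝓛) : Set where
    field
      +ᴹ-homo : ∀ f g → T (f +ᴹ g) ≡ T f +ᴹ T g
      0ᴹ-homo : T 0ᴹ ≡ 0ᴹ

    sum-homo : ∀ {m} (t : Fin m → 𝓛) → T (sumᴹ t) ≡ sumᴹ (T ∘ t)
    sum-homo {zero}  t = 0ᴹ-homo
    sum-homo {suc m} t = trans (+ᴹ-homo _ _) (cong (T (t zero) +ᴹ_) (sum-homo (t ∘ suc)))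

  open Additive

  coef-sum : ∀ {m} (t : Fin m → 𝓛) j → coef (sumᴹ t) j ≡ sum (λ i → coef (t i) j)
  coef-sum {zero}  t j = coef-0 j
  coef-sum {suc m} t j = trans (coef-+ _ _ j) (cong (coef (t zero) j +_) (coef-sum (t ∘ suc) j))

  sum-monomials : ∀ f → f ≡ sumᴹ (λ i → monomial (lookup f i) (toℕ i))
  sum-monomials f = coef-ext λ m → sym (begin
    coef (sumᴹ (λ i → monomial (lookup f i) (toℕ i))) m      ≡⟨ coef-sum (λ i → monomial (lookup f i) (toℕ i)) m ⟩
    sum (λ i → coef (monomial (lookup f i) (toℕ i)) m)
      ≡⟨ ∑.sum-single _ (m mod n) (λ i i≢m → coef-monomial-≋̸ _ (i≢m ∘ λ p →
           trans (sym (toℕ-mod i)) (Fin.fromℕ<-cong _ _ (sym p) (m%n<n _ n) (m%n<n m n)))) ⟩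
    coef (monomial (lookup f (m mod n)) (toℕ (m mod n))) m
      ≡⟨ coef-monomial-≋ _ (sym (trans (cong (_% n) (Fin.toℕ-fromℕ< (m%n<n m n))) (%-≋ m))) ⟩
    lookup f (m mod n)                                        ≡⟨ coef-lookup f m ⟨
    coef f m                                                  ∎)

  -- Every polynomial is the sum of its terms. Identities between compositions thus reduce to
  -- monomials, where `monomial-∘` gives a closed form.
  additive-ext : ∀ {S T} → Additive S → Additive T →
                 (∀ a i → S (monomial a i) ≡ T (monomial a i)) → ∀ f → S f ≡ T f
  additive-ext {S} {T} S-add T-add eq f = begin
    S f               ≡⟨ cong S (sum-monomials f) ⟩
    S (sumᴹ terms)    ≡⟨ sum-homo S-add terms ⟩
    sumᴹ (S ∘ terms)  ≡⟨ ∑ᴹ.sum-cong-≗ {x = S ∘ terms} {T ∘ terms} (λ i → eq (lookup f i) (toℕ i)) ⟩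
    sumᴹ (T ∘ terms)  ≡⟨ sum-homo T-add terms ⟨
    T (sumᴹ terms)    ≡⟨ cong T (sum-monomials f) ⟨
    T f               ∎
    where
    terms : Fin n → 𝓛
    terms i = monomial (lookup f i) (toℕ i)

  additive-∘ : ∀ {S T} → Additive S → Additive T → Additive (S ∘ T)
  additive-∘ {S} S-add T-add = record
    { +ᴹ-homo = λ f g → trans (cong S (+ᴹ-homo T-add f g)) (+ᴹ-homo S-add _ _)
    ; 0ᴹ-homo = trans (cong S (0ᴹ-homo T-add)) (0ᴹ-homo S-add) }

  private
    term : 𝓛 → 𝓛 → Fin n → Fin n → 𝓛
    term f g i j = monomial (lookup f i * lookup g j ^[ toℕ i ]) (toℕ i ℕ.+ toℕ j)

    bilinear-sum : ∀ {t u v : Fin n → Fin n → 𝓛} → (∀ i j → t i j ≡ u i j +ᴹ v i j) →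
      sumᴹ (λ i → sumᴹ (t i)) ≡ sumᴹ (λ i → sumᴹ (u i)) +ᴹ sumᴹ (λ i → sumᴹ (v i))
    bilinear-sum {t} {u} {v} eq = trans
      (∑ᴹ.sum-cong-≗ {x = λ i → sumᴹ (t i)} {λ i → sumᴹ (u i) +ᴹ sumᴹ (v i)} λ i → trans
        (∑ᴹ.sum-cong-≗ {x = t i} {λ j → u i j +ᴹ v i j} (eq i)) (∑ᴹ.∑-distrib-+ (u i) (v i)))
      (∑ᴹ.∑-distrib-+ (λ i → sumᴹ (u i)) (λ i → sumᴹ (v i)))

    sum-sum-0 : ∀ {t : Fin n → Fin n → 𝓛} → (∀ i j → t i j ≡ 0ᴹ) → sumᴹ (λ i → sumᴹ (t i)) ≡ 0ᴹ
    sum-sum-0 {t} eq = ∑ᴹ.sum-ε (λ i → sumᴹ (t i)) λ i → ∑ᴹ.sum-ε (t i) (eq i)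

  ∘-additiveˡ : ∀ g → Additive (_∘ᴸ g)
  ∘-additiveˡ g = record
    { +ᴹ-homo = λ f f′ → bilinear-sum {term (f +ᴹ f′) g} {term f g} {term f′ g} λ i j → trans
        (cong (λ a → monomial a (toℕ i ℕ.+ toℕ j))
          (trans (cong (_* lookup g j ^[ toℕ i ]) (Vec.lookup-zipWith _+_ i f f′)) (distribʳ _ _ _)))
        (monomial-+ _ _ _)
    ; 0ᴹ-homo = sum-sum-0 {term 0ᴹ g} λ i j → trans
        (cong (λ a → monomial a (toℕ i ℕ.+ toℕ j))
          (trans (cong (_* lookup g j ^[ toℕ i ]) (Vec.lookup-replicate {n = n} i 0#)) (zeroˡ _)))
        (monomial-0 _) }

  ∘-additiveʳ : ∀ f → Additive (f ∘ᴸ_)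
  ∘-additiveʳ f = record
    { +ᴹ-homo = λ g g′ → bilinear-sum {term f (g +ᴹ g′)} {term f g} {term f g′} λ i j → trans
        (cong (λ a → monomial a (toℕ i ℕ.+ toℕ j))
          (trans (cong (λ b → lookup f i * b ^[ toℕ i ]) (Vec.lookup-zipWith _+_ j g g′))
            (trans (cong (lookup f i *_) (frobenius-+ (toℕ i) _ _)) (distribˡ _ _ _))))
        (monomial-+ _ _ _)
    ; 0ᴹ-homo = sum-sum-0 {term f 0ᴹ} λ i j → trans
        (cong (λ a → monomial a (toℕ i ℕ.+ toℕ j))
          (trans (cong (λ b → lookup f i * b ^[ toℕ i ]) (Vec.lookup-replicate {n = n} j 0#))
            (trans (cong (lookup f i *_) (frobenius-0 (toℕ i))) (zeroʳ _))))
        (monomial-0 _) }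

  lookup-monomial-mod : ∀ a i → lookup (monomial a i) (i mod n) ≡ a
  lookup-monomial-mod a i = trans (sym (coef-lookup _ i)) (coef-monomial-≋ a {i} refl)

  lookup-monomial-≢ : ∀ a i j → j ≢ i mod n → lookup (monomial a i) j ≡ 0#
  lookup-monomial-≢ a i j j≢ = subst (λ k → lookup (monomial a i) k ≡ 0#) (toℕ-mod j)
    (trans (sym (coef-lookup _ _)) (coef-monomial-≋̸ a λ p →
      j≢ (trans (sym (toℕ-mod j)) (Fin.fromℕ<-cong _ _ p (m%n<n _ n) (m%n<n i n)))))

  toℕ-mod-≋ : ∀ i → toℕ (i mod n) ≋ i
  toℕ-mod-≋ i = trans (cong (_% n) (Fin.toℕ-fromℕ< (m%n<n i n))) (%-≋ i)

  monomial-∘ : ∀ a i b j → monomial a i ∘ᴸ monomial b j ≡ monomial (a * b ^[ i ]) (i ℕ.+ j)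
  monomial-∘ a i b j = begin
    monomial a i ∘ᴸ monomial b j
      ≡⟨ ∑ᴹ.sum-single (λ k → sumᴹ (term (monomial a i) (monomial b j) k)) (i mod n) (λ k k≢ →
           ∑ᴹ.sum-ε (term (monomial a i) (monomial b j) k) λ l → trans
           (cong (λ c → monomial c (toℕ k ℕ.+ toℕ l))
             (trans (cong (_* _) (lookup-monomial-≢ a i k k≢)) (zeroˡ _)))
           (monomial-0 _)) ⟩
    sumᴹ (term (monomial a i) (monomial b j) (i mod n))
      ≡⟨ ∑ᴹ.sum-single (term (monomial a i) (monomial b j) (i mod n)) (j mod n) (λ l l≢ → trans
           (cong (λ c → monomial c (toℕ (i mod n) ℕ.+ toℕ l))
             (trans (cong (λ d → lookup (monomial a i) (i mod n) * d ^[ toℕ (i mod n) ]) (lookup-monomial-≢ b j l l≢))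
               (trans (cong (_ *_) (frobenius-0 (toℕ (i mod n)))) (zeroʳ _))))
           (monomial-0 _)) ⟩
    term (monomial a i) (monomial b j) (i mod n) (j mod n)
      ≡⟨ cong₂ (λ c d → monomial (c * d ^[ toℕ (i mod n) ]) (toℕ (i mod n) ℕ.+ toℕ (j mod n)))
           (lookup-monomial-mod a i) (lookup-monomial-mod b j) ⟩
    monomial (a * b ^[ toℕ (i mod n) ]) (toℕ (i mod n) ℕ.+ toℕ (j mod n))
      ≡⟨ cong (λ c → monomial (a * c) _) (frobenius-≋ (toℕ-mod-≋ i) b) ⟩
    monomial (a * b ^[ i ]) (toℕ (i mod n) ℕ.+ toℕ (j mod n))
      ≡⟨ monomial-≋ _ (≋-+ (toℕ-mod-≋ i) (toℕ-mod-≋ j)) ⟩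
    monomial (a * b ^[ i ]) (i ℕ.+ j) ∎

  -- Both sides are additive in each of the three arguments. On monomials the claim says that the
  -- Frobenius powers are multiplicative and compose by adding exponents.
  ∘-assoc : ∀ f g h → (f ∘ᴸ g) ∘ᴸ h ≡ f ∘ᴸ (g ∘ᴸ h)
  ∘-assoc f g h = additive-ext
    (additive-∘ (∘-additiveˡ h) (∘-additiveˡ g)) (∘-additiveˡ (g ∘ᴸ h))
    (λ a i → additive-ext
      (additive-∘ (∘-additiveˡ h) (∘-additiveʳ (monomial a i)))
      (additive-∘ (∘-additiveʳ (monomial a i)) (∘-additiveˡ h))
      (λ b j → additive-ext
        (∘-additiveʳ (monomial a i ∘ᴸ monomial b j))
        (additive-∘ (∘-additiveʳ (monomial a i)) (∘-additiveʳ (monomial b j)))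
        (λ c l → monomial-assoc a i b j c l) h) g) f
    where
    monomial-assoc : ∀ a i b j c l →
      (monomial a i ∘ᴸ monomial b j) ∘ᴸ monomial c l ≡ monomial a i ∘ᴸ (monomial b j ∘ᴸ monomial c l)
    monomial-assoc a i b j c l = begin
      (monomial a i ∘ᴸ monomial b j) ∘ᴸ monomial c l
        ≡⟨ cong (_∘ᴸ monomial c l) (monomial-∘ a i b j) ⟩
      monomial (a * b ^[ i ]) (i ℕ.+ j) ∘ᴸ monomial c l
        ≡⟨ monomial-∘ _ (i ℕ.+ j) c l ⟩
      monomial (a * b ^[ i ] * c ^[ i ℕ.+ j ]) (i ℕ.+ j ℕ.+ l)
        ≡⟨ cong₂ monomial (begin
             a * b ^[ i ] * c ^[ i ℕ.+ j ]      ≡⟨ *-assoc a _ _ ⟩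
             a * (b ^[ i ] * c ^[ i ℕ.+ j ])    ≡⟨ cong (λ k → a * (b ^[ i ] * c ^[ k ])) (ℕ.+-comm i j) ⟩
             a * (b ^[ i ] * c ^[ j ℕ.+ i ])    ≡⟨ cong (λ d → a * (b ^[ i ] * d)) (frobenius-frobenius j i c) ⟨
             a * (b ^[ i ] * c ^[ j ] ^[ i ])   ≡⟨ cong (a *_) (frobenius-* i b _) ⟨
             a * (b * c ^[ j ]) ^[ i ]          ∎) (ℕ.+-assoc i j l) ⟩
      monomial (a * (b * c ^[ j ]) ^[ i ]) (i ℕ.+ (j ℕ.+ l))
        ≡⟨ monomial-∘ a i _ (j ℕ.+ l) ⟨
      monomial a i ∘ᴸ monomial (b * c ^[ j ]) (j ℕ.+ l)
        ≡⟨ cong (monomial a i ∘ᴸ_) (monomial-∘ b j c l) ⟨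
      monomial a i ∘ᴸ (monomial b j ∘ᴸ monomial c l) ∎

  id-additive : Additive id
  id-additive = record { +ᴹ-homo = λ _ _ → refl ; 0ᴹ-homo = refl }

  ∘-identityˡ : ∀ f → x^[ 0 ] ∘ᴸ f ≡ f
  ∘-identityˡ = additive-ext (∘-additiveʳ x^[ 0 ]) id-additive λ a i →
    trans (monomial-∘ 1# 0 a i) (cong (λ b → monomial b i) (trans (*-identityˡ _) (frobenius-zero a)))

  ∘-identityʳ : ∀ f → f ∘ᴸ x^[ 0 ] ≡ f
  ∘-identityʳ = additive-ext (∘-additiveˡ x^[ 0 ]) id-additive λ a i →
    trans (monomial-∘ a i 1# 0) (cong₂ monomial
      (trans (cong (a *_) (frobenius-1 i)) (*-identityʳ a)) (ℕ.+-identityʳ i))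

  coef-*ₗ : ∀ a f m → coef (a *ₗ f) m ≡ a * coef f m
  coef-*ₗ a f m = coef-map (a *_) f m

  *ₗ-additive : ∀ a → Additive (a *ₗ_)
  *ₗ-additive a = record
    { +ᴹ-homo = λ f g → coef-ext λ m → trans (coef-*ₗ a _ m) (trans (cong (a *_) (coef-+ f g m))
        (trans (distribˡ a _ _) (sym (trans (coef-+ _ _ m) (cong₂ _+_ (coef-*ₗ a f m) (coef-*ₗ a g m))))))
    ; 0ᴹ-homo = coef-ext λ m → trans (coef-*ₗ a _ m)
        (trans (cong (a *_) (coef-0 m)) (trans (zeroʳ a) (sym (coef-0 m)))) }

  *ₗ-monomial : ∀ a b i → a *ₗ monomial b i ≡ monomial (a * b) i
  *ₗ-monomial a b i = map-monomial (a *_) b i (zeroʳ a)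

  *ₗ-as-∘ : ∀ a f → a *ₗ f ≡ monomial a 0 ∘ᴸ f
  *ₗ-as-∘ a = additive-ext (*ₗ-additive a) (∘-additiveʳ (monomial a 0)) λ b i →
    trans (*ₗ-monomial a b i) (sym (trans (monomial-∘ a 0 b i)
      (cong (λ c → monomial (a * c) i) (frobenius-zero b))))

  *ₗ-∘ : ∀ a f g → (a *ₗ f) ∘ᴸ g ≡ a *ₗ (f ∘ᴸ g)
  *ₗ-∘ a f g = trans (cong (_∘ᴸ g) (*ₗ-as-∘ a f)) (trans (∘-assoc (monomial a 0) f g) (sym (*ₗ-as-∘ a (f ∘ᴸ g))))

  *ₗ-*ₗ : ∀ a b f → a *ₗ (b *ₗ f) ≡ (a * b) *ₗ f
  *ₗ-*ₗ a b f = coef-ext λ m → trans (coef-*ₗ a _ m) (trans (cong (a *_) (coef-*ₗ b f m))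
    (trans (sym (*-assoc a b _)) (sym (coef-*ₗ (a * b) f m))))

  1#-*ₗ : ∀ f → 1# *ₗ f ≡ f
  1#-*ₗ f = coef-ext λ m → trans (coef-*ₗ 1# f m) (*-identityˡ _)

  0#-*ₗ : ∀ f → 0# *ₗ f ≡ 0ᴹ
  0#-*ₗ f = coef-ext λ m → trans (coef-*ₗ 0# f m) (trans (zeroˡ _) (sym (coef-0 m)))

  -- If only the monomials in the class of `i` contribute to position `m`, then the sum over the
  -- terms of `f` collapses to one summand. Both composition rules for coefficients below are
  -- instances.
  coef-additive : ∀ {T} → Additive T → ∀ i m (φ : Carrier → Carrier) →
    (∀ b l → l ≋ i → coef (T (monomial b l)) m ≡ φ b) →
    (∀ b l → ¬ (l ≋ i) → coef (T (monomial b l)) m ≡ 0#) →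
    ∀ f → coef (T f) m ≡ φ (coef f i)
  coef-additive {T} T-add i m φ at off f = begin
    coef (T f) m                           ≡⟨ cong (λ g → coef (T g) m) (sum-monomials f) ⟩
    coef (T (sumᴹ terms)) m                ≡⟨ cong (λ g → coef g m) (sum-homo T-add terms) ⟩
    coef (sumᴹ (T ∘ terms)) m              ≡⟨ coef-sum (T ∘ terms) m ⟩
    sum (λ l → coef (T (terms l)) m)
      ≡⟨ ∑.sum-single (λ l → coef (T (terms l)) m) (i mod n) (λ l l≢ → off _ (toℕ l) λ p →
           l≢ (trans (sym (toℕ-mod l)) (Fin.fromℕ<-cong _ _ p (m%n<n _ n) (m%n<n i n)))) ⟩
    coef (T (terms (i mod n))) m           ≡⟨ at _ _ (toℕ-mod-≋ i) ⟩
    φ (lookup f (i mod n))                 ≡⟨ cong φ (coef-lookup f i) ⟨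
    φ (coef f i)                           ∎
    where
    terms : Fin n → 𝓛
    terms l = monomial (lookup f l) (toℕ l)

  coef-monomial-∘ : ∀ a j f i → coef (monomial a j ∘ᴸ f) (i ℕ.+ j) ≡ a * coef f i ^[ j ]
  coef-monomial-∘ a j f i = coef-additive (∘-additiveʳ (monomial a j)) i (i ℕ.+ j) (λ b → a * b ^[ j ])
    (λ b l p → trans (cong (λ g → coef g (i ℕ.+ j)) (monomial-∘ a j b l))
      (coef-monomial-≋ _ (trans (cong (_% n) (ℕ.+-comm i j)) (≋-+ {j} refl (sym p)))))
    (λ b l p → trans (cong (λ g → coef g (i ℕ.+ j)) (monomial-∘ a j b l))
      (coef-monomial-≋̸ _ λ r → p (sym (≋-+-cancelʳ j (trans r (cong (_% n) (ℕ.+-comm j l)))))))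
    f

  coef-∘-monomial : ∀ f b j i → coef (f ∘ᴸ monomial b j) (i ℕ.+ j) ≡ coef f i * b ^[ i ]
  coef-∘-monomial f b j i = coef-additive (∘-additiveˡ (monomial b j)) i (i ℕ.+ j) (λ c → c * b ^[ i ])
    (λ c l p → trans (cong (λ g → coef g (i ℕ.+ j)) (monomial-∘ c l b j))
      (trans (coef-monomial-≋ _ (≋-+ {j = j} (sym p) refl)) (cong (c *_) (frobenius-≋ p b))))
    (λ c l p → trans (cong (λ g → coef g (i ℕ.+ j)) (monomial-∘ c l b j))
      (coef-monomial-≋̸ _ λ r → p (sym (≋-+-cancelʳ j r))))
    f

  -- One interface for the automorphism in an equivalence, its inverse and the powers of Frobenius,
  -- all of which are applied to coefficients.
  record Endomorphism (σ : Carrier → Carrier) : Set where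
    field
      +-homo : ∀ x y → σ (x + y) ≡ σ x + σ y
      *-homo : ∀ x y → σ (x * y) ≡ σ x * σ y
      0-homo : σ 0# ≡ 0#
      1-homo : σ 1# ≡ 1#

    ^-homo : ∀ x m → σ (x ^ m) ≡ σ x ^ m
    ^-homo x zero    = 1-homo
    ^-homo x (suc m) = trans (*-homo x (x ^ m)) (cong (σ x *_) (^-homo x m))

    product-homo : ∀ {m} (t : Fin m → Carrier) → σ (product t) ≡ product (σ ∘ t)
    product-homo {zero}  t = 1-homo
    product-homo {suc m} t = trans (*-homo _ _) (cong (σ (t zero) *_) (product-homo (t ∘ suc)))

    norm-homo : ∀ η → σ (norm η) ≡ norm (σ η)
    norm-homo η = trans (product-homo {n} (λ i → η ^[ toℕ i ]))
      (∏.sum-cong-≗ {n} (λ i → ^-homo η (q ℕ.^ toℕ i)))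

    neg-homo : ∀ x → σ (- x) ≡ - σ x
    neg-homo x = +-cancelˡ (σ x) _ _
      (trans (sym (+-homo x (- x))) (trans (cong σ (-‿inverseʳ x)) (trans 0-homo (sym (-‿inverseʳ (σ x))))))

    map-additive : Additive (map σ)
    map-additive = record
      { +ᴹ-homo = λ f g → coef-ext λ m → trans (coef-map σ _ m) (trans (cong σ (coef-+ f g m))
          (trans (+-homo _ _) (sym (trans (coef-+ _ _ m) (cong₂ _+_ (coef-map σ f m) (coef-map σ g m))))))
      ; 0ᴹ-homo = coef-ext λ m → trans (coef-map σ _ m)
          (trans (cong σ (coef-0 m)) (trans 0-homo (sym (coef-0 m)))) }

    map-∘ : ∀ f g → map σ (f ∘ᴸ g) ≡ map σ f ∘ᴸ map σ g
    map-∘ f g = additive-ext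
      (additive-∘ map-additive (∘-additiveˡ g)) (additive-∘ (∘-additiveˡ (map σ g)) map-additive)
      (λ a i → additive-ext
        (additive-∘ map-additive (∘-additiveʳ (monomial a i)))
        (additive-∘ (∘-additiveʳ (map σ (monomial a i))) map-additive)
        (λ b j → begin
          map σ (monomial a i ∘ᴸ monomial b j)        ≡⟨ cong (map σ) (monomial-∘ a i b j) ⟩
          map σ (monomial (a * b ^[ i ]) (i ℕ.+ j))   ≡⟨ map-monomial σ _ (i ℕ.+ j) 0-homo ⟩
          monomial (σ (a * b ^[ i ])) (i ℕ.+ j)
            ≡⟨ cong (λ c → monomial c (i ℕ.+ j)) (trans (*-homo _ _) (cong (σ a *_) (^-homo b (q ℕ.^ i)))) ⟩
          monomial (σ a * σ b ^[ i ]) (i ℕ.+ j)       ≡⟨ monomial-∘ (σ a) i (σ b) j ⟨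
          monomial (σ a) i ∘ᴸ monomial (σ b) j
            ≡⟨ cong₂ _∘ᴸ_ (map-monomial σ a i 0-homo) (map-monomial σ b j 0-homo) ⟨
          map σ (monomial a i) ∘ᴸ map σ (monomial b j) ∎) g) f

    map-*ₗ : ∀ a f → map σ (a *ₗ f) ≡ σ a *ₗ map σ f
    map-*ₗ a f = coef-ext λ m → trans (coef-map σ _ m) (trans (cong σ (coef-*ₗ a f m))
      (trans (*-homo a _) (sym (trans (coef-*ₗ (σ a) _ m) (cong (σ a *_) (coef-map σ f m))))))

    map-x^ : ∀ i → map σ x^[ i ] ≡ x^[ i ]
    map-x^ i = trans (map-monomial σ 1# i 0-homo) (cong (λ a → monomial a i) 1-homo)

  frobenius-endomorphism : ∀ i → Endomorphism (_^[ i ])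
  frobenius-endomorphism i = record
    { +-homo = frobenius-+ i ; *-homo = frobenius-* i ; 0-homo = frobenius-0 i ; 1-homo = frobenius-1 i }

  -- This is what allows a monomial `h` to be absorbed: its power of `x` moves past `f` at the price
  -- of a Frobenius twist of the coefficients, and then joins `g`.
  x^-∘ : ∀ i f → x^[ i ] ∘ᴸ f ≡ map (_^[ i ]) f ∘ᴸ x^[ i ]
  x^-∘ i = additive-ext (∘-additiveʳ x^[ i ])
    (additive-∘ (∘-additiveˡ x^[ i ]) (Endomorphism.map-additive (frobenius-endomorphism i)))
    λ a j → begin
      x^[ i ] ∘ᴸ monomial a j                     ≡⟨ monomial-∘ 1# i a j ⟩
      monomial (1# * a ^[ i ]) (i ℕ.+ j)
        ≡⟨ cong₂ monomial (trans (*-comm 1# _) (cong (a ^[ i ] *_) (sym (frobenius-1 j)))) (ℕ.+-comm i j) ⟩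
      monomial (a ^[ i ] * 1# ^[ j ]) (j ℕ.+ i)   ≡⟨ monomial-∘ _ j 1# i ⟨
      monomial (a ^[ i ]) j ∘ᴸ x^[ i ]
        ≡⟨ cong (_∘ᴸ x^[ i ]) (map-monomial (_^[ i ]) a j (frobenius-0 i)) ⟨
      map (_^[ i ]) (monomial a j) ∘ᴸ x^[ i ]     ∎

  x^-∘-x^ : ∀ i j → x^[ i ] ∘ᴸ x^[ j ] ≡ x^[ i ℕ.+ j ]
  x^-∘-x^ i j = trans (monomial-∘ 1# i 1# j)
    (cong (λ a → monomial a (i ℕ.+ j)) (trans (*-identityˡ _) (frobenius-1 i)))

  coef-combination : ∀ {d} c (b : Fin d → 𝓛) m →
                     coef (combination c b) m ≡ sum (λ i → c i * coef (b i) m)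
  coef-combination c b m = trans (coef-sum (λ i → c i *ₗ b i) m) (∑.sum-cong-≗ λ i → coef-*ₗ (c i) (b i) m)

  combination-cong : ∀ {d} {c c′ : Fin d → Carrier} {b b′ : Fin d → 𝓛} →
    (∀ i → c i ≡ c′ i) → (∀ i → b i ≡ b′ i) → combination c b ≡ combination c′ b′
  combination-cong {c = c} {c′} {b} {b′} c≡ b≡ =
    ∑ᴹ.sum-cong-≗ {x = λ i → c i *ₗ b i} {λ i → c′ i *ₗ b′ i} λ i → cong₂ _*ₗ_ (c≡ i) (b≡ i)

  combination-homo : ∀ {T τ} → Additive T → (∀ a f → T (a *ₗ f) ≡ τ a *ₗ T f) →
    ∀ {d} c (b : Fin d → 𝓛) → T (combination c b) ≡ combination (τ ∘ c) (T ∘ b)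
  combination-homo {T} {τ} T-add T-*ₗ c b = trans (sum-homo T-add (λ i → c i *ₗ b i))
    (∑ᴹ.sum-cong-≗ {x = λ i → T (c i *ₗ b i)} {λ i → τ (c i) *ₗ T (b i)} λ i → T-*ₗ (c i) (b i))

  combination-∘ : ∀ {d} c (b : Fin d → 𝓛) g → combination c b ∘ᴸ g ≡ combination c (λ i → b i ∘ᴸ g)
  combination-∘ c b g = combination-homo {τ = id} (∘-additiveˡ g) (λ a f → *ₗ-∘ a f g) c b

  *ₗ-combination : ∀ a {d} c (b : Fin d → 𝓛) → a *ₗ combination c b ≡ combination (λ i → a * c i) b
  *ₗ-combination a c b = trans (sum-homo (*ₗ-additive a) (λ i → c i *ₗ b i))
    (∑ᴹ.sum-cong-≗ {x = λ i → a *ₗ (c i *ₗ b i)} {λ i → (a * c i) *ₗ b i} λ i → *ₗ-*ₗ a (c i) (b i))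

-- Coefficients indexed by the multiples of `s`

open import Data.Nat.GCD using (gcd; module Bézout)
open import Data.Nat.Coprimality using (coprime-Bézout; gcd≡1⇒coprime)
open import Relation.Unary using (Pred; U; _∈_; _∩_; _≐_)
module CoprimeIndexing (q n : ℕ) .{{_ : NonZero n}} (q-primePower : IsPrimePower q)
                       (F : FiniteField (q ℕ.^ n)) (s : ℕ) (gcd≡1 : gcd s n ≡ 1) where
  open LinearizedPolynomials q n q-primePower F

  private
    inverse : ∃[ t ] t ℕ.* s ≋ 1
    inverse = from (coprime-Bézout (gcd≡1⇒coprime gcd≡1))
      where
      from : Bézout.Identity 1 s n → ∃[ t ] t ℕ.* s ≋ 1
      from (Bézout.+- x y 1+yn≡xs) = x , trans (cong (_% n) (sym 1+yn≡xs)) (≋-+-multiple 1 y)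
      -- Here `x * s` is congruent to -1, so the inverse of `s` is `-x`, represented by
      -- `x * (n ∸ 1)`.
      from (Bézout.-+ x y 1+xs≡yn) = x ℕ.* (n ∸ 1) , ≋-+-cancelʳ (x ℕ.* s) (begin
        (x ℕ.* (n ∸ 1) ℕ.* s ℕ.+ x ℕ.* s) % n     ≡⟨ cong (_% n) (ℕ.+-comm _ (x ℕ.* s)) ⟩
        (x ℕ.* s ℕ.+ x ℕ.* (n ∸ 1) ℕ.* s) % n     ≡⟨ cong (λ r → (x ℕ.* s ℕ.+ r) % n) swap ⟩
        (x ℕ.* s ℕ.+ x ℕ.* s ℕ.* (n ∸ 1)) % n     ≡⟨ ≋-inverse 0 (x ℕ.* s) ⟩
        0 % n                                      ≡⟨ ≋-+-multiple 0 y ⟨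
        (y ℕ.* n) % n                              ≡⟨ cong (_% n) 1+xs≡yn ⟨
        (1 ℕ.+ x ℕ.* s) % n                        ∎)
        where
        swap : x ℕ.* (n ∸ 1) ℕ.* s ≡ x ℕ.* s ℕ.* (n ∸ 1)
        swap = trans (ℕ.*-assoc x _ s) (trans (cong (x ℕ.*_) (ℕ.*-comm _ s)) (sym (ℕ.*-assoc x s _)))

    t : ℕ
    t = proj₁ inverse

    t*s*i≋i : ∀ i → t ℕ.* (s ℕ.* i) ≋ i
    t*s*i≋i i = trans (cong (_% n) (sym (ℕ.*-assoc t s i)))
      (trans (≋-* {j = i} (proj₂ inverse) refl) (cong (_% n) (ℕ.*-identityˡ i)))

    s*t*i≋i : ∀ i → s ℕ.* (t ℕ.* i) ≋ i
    s*t*i≋i i = trans (cong (_% n) (trans (sym (ℕ.*-assoc s t i))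
      (trans (cong (ℕ._* i) (ℕ.*-comm s t)) (ℕ.*-assoc t s i)))) (t*s*i≋i i)

  s*-≋ : ∀ {i j} → i ≋ j → s ℕ.* i ≋ s ℕ.* j
  s*-≋ {i} {j} = ≋-* {s} {s} {i} {j} refl

  s*-≋⁻¹ : ∀ {i j} → s ℕ.* i ≋ s ℕ.* j → i ≋ j
  s*-≋⁻¹ {i} {j} p = trans (sym (t*s*i≋i i)) (trans (≋-* {t} refl p) (t*s*i≋i j))

  -- The coefficient of x^[si]; as s is invertible modulo n, these are all the
  -- coefficients, and i matters only modulo n.
  coefˢ : 𝓛 → ℕ → Carrier
  coefˢ f i = coef f (s ℕ.* i)

  coefˢ-≋ : ∀ f {i j} → i ≋ j → coefˢ f i ≡ coefˢ f j
  coefˢ-≋ f p = coef-≋ f (s*-≋ p)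

  coefˢ-+n : ∀ f i → coefˢ f (n ℕ.+ i) ≡ coefˢ f i
  coefˢ-+n f i = coefˢ-≋ f (trans (cong (_% n) (trans (ℕ.+-comm n i) (cong (i ℕ.+_) (sym (ℕ.*-identityˡ n)))))
    (≋-+-multiple i 1))

  coefˢ-ext : ∀ {f g} → (∀ i → i < n → coefˢ f i ≡ coefˢ g i) → f ≡ g
  coefˢ-ext {f} {g} eq = coef-ext λ m → begin
    coef f m                     ≡⟨ coef-≋ f (s*t*i≋i m) ⟨
    coefˢ f (t ℕ.* m)            ≡⟨ coefˢ-≋ f (%-≋ (t ℕ.* m)) ⟨
    coefˢ f ((t ℕ.* m) % n)      ≡⟨ eq _ (m%n<n _ n) ⟩
    coefˢ g ((t ℕ.* m) % n)      ≡⟨ coefˢ-≋ g (%-≋ (t ℕ.* m)) ⟩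
    coefˢ g (t ℕ.* m)            ≡⟨ coef-≋ g (s*t*i≋i m) ⟩
    coef g m                     ∎

  coefˢ-window-ext : ∀ a {f g} → (∀ i → a ≤ i → i < n ℕ.+ a → coefˢ f i ≡ coefˢ g i) → f ≡ g
  coefˢ-window-ext a {f} {g} eq = coefˢ-ext λ i _ → case representative a i of λ where
    (j , a≤j , j<n+a , j≋i) → trans (coefˢ-≋ f (sym j≋i)) (trans (eq j a≤j j<n+a) (coefˢ-≋ g j≋i))

  coefˢ-x^-≋ : ∀ {i j} → i ≋ j → coefˢ x^[ s ℕ.* j ] i ≡ 1#
  coefˢ-x^-≋ p = coef-monomial-≋ 1# (s*-≋ p)

  coefˢ-x^-≋̸ : ∀ {i j} → ¬ (i ≋ j) → coefˢ x^[ s ℕ.* j ] i ≡ 0#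
  coefˢ-x^-≋̸ p = coef-monomial-≋̸ 1# (p ∘ s*-≋⁻¹)

  coefˢ-∘-x^ : ∀ f j i → coefˢ (f ∘ᴸ x^[ s ℕ.* j ]) (i ℕ.+ j) ≡ coefˢ f i
  coefˢ-∘-x^ f j i = begin
    coefˢ (f ∘ᴸ x^[ s ℕ.* j ]) (i ℕ.+ j)                   ≡⟨ cong (coef _) (ℕ.*-distribˡ-+ s i j) ⟩
    coef (f ∘ᴸ x^[ s ℕ.* j ]) (s ℕ.* i ℕ.+ s ℕ.* j)        ≡⟨ coef-∘-monomial f 1# (s ℕ.* j) (s ℕ.* i) ⟩
    coefˢ f i * 1# ^[ s ℕ.* i ]                            ≡⟨ cong (coefˢ f i *_) (frobenius-1 (s ℕ.* i)) ⟩
    coefˢ f i * 1#                                         ≡⟨ *-identityʳ _ ⟩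
    coefˢ f i                                              ∎

  coefˢ-x^-∘ : ∀ f j i → coefˢ (x^[ s ℕ.* j ] ∘ᴸ f) (i ℕ.+ j) ≡ coefˢ f i ^[ s ℕ.* j ]
  coefˢ-x^-∘ f j i = begin
    coefˢ (x^[ s ℕ.* j ] ∘ᴸ f) (i ℕ.+ j)                   ≡⟨ cong (coef _) (ℕ.*-distribˡ-+ s i j) ⟩
    coef (x^[ s ℕ.* j ] ∘ᴸ f) (s ℕ.* i ℕ.+ s ℕ.* j)        ≡⟨ coef-monomial-∘ 1# (s ℕ.* j) f (s ℕ.* i) ⟩
    1# * coefˢ f i ^[ s ℕ.* j ]                            ≡⟨ *-identityˡ _ ⟩
    coefˢ f i ^[ s ℕ.* j ]                                 ∎

  -- The bound `hi` may exceed `n`. As positions wrap, `Zeros f k (n + a)` also forces the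
  -- coefficients at 0, ..., `a - 1` to vanish, which leaves just the places from `a` to `k - 1`.
  Zeros : 𝓛 → ℕ → ℕ → Set
  Zeros f lo hi = ∀ i → lo ≤ i → i < hi → coefˢ f i ≡ 0#

  consecutive : ∀ a d → Fin d → 𝓛
  consecutive a d j = x^[ s ℕ.* (a ℕ.+ toℕ j) ]

  module _ {a d : ℕ} (d≤n : d ≤ n) where

    coefˢ-consecutive : ∀ c j → coefˢ (combination c (consecutive a d)) (a ℕ.+ toℕ j) ≡ c j
    coefˢ-consecutive c j = begin
      coefˢ (combination c (consecutive a d)) (a ℕ.+ toℕ j)
        ≡⟨ coef-combination c (consecutive a d) (s ℕ.* (a ℕ.+ toℕ j)) ⟩
      sum (λ i → c i * coefˢ (consecutive a d i) (a ℕ.+ toℕ j))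
        ≡⟨ ∑.sum-single (λ i → c i * coefˢ (consecutive a d i) (a ℕ.+ toℕ j)) j (λ i i≢j →
             trans (cong (c i *_) (coefˢ-x^-≋̸ (i≢j ∘ sym ∘ distinct i))) (zeroʳ _)) ⟩
      c j * coefˢ (consecutive a d j) (a ℕ.+ toℕ j)
        ≡⟨ trans (cong (c j *_) (coefˢ-x^-≋ {a ℕ.+ toℕ j} refl)) (*-identityʳ _) ⟩
      c j ∎
      where
      distinct : ∀ i → a ℕ.+ toℕ j ≋ a ℕ.+ toℕ i → j ≡ i
      distinct i p = Fin.toℕ-injective (≋-< (ℕ.<-≤-trans (Fin.toℕ<n j) d≤n) (ℕ.<-≤-trans (Fin.toℕ<n i) d≤n)
        (≋-+-cancelʳ a (trans (cong (_% n) (ℕ.+-comm (toℕ j) a)) (trans p (cong (_% n) (ℕ.+-comm a (toℕ i)))))))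

    consecutive-zeros : ∀ c → Zeros (combination c (consecutive a d)) (a ℕ.+ d) (n ℕ.+ a)
    consecutive-zeros c i a+d≤i i<n+a = trans (coef-combination c (consecutive a d) (s ℕ.* i))
      (∑.sum-ε _ λ j → trans (cong (c j *_) (coefˢ-x^-≋̸ λ p → ≋-window
        (ℕ.<-≤-trans (ℕ.+-monoʳ-< a (Fin.toℕ<n j)) a+d≤i)
        (ℕ.<-≤-trans i<n+a (ℕ.+-monoʳ-≤ n (ℕ.m≤m+n a (toℕ j)))) (sym p))) (zeroʳ _))

    -- The window from `a` to `n + a` meets each residue class once. Its first `d` places are the
    -- coordinates, and the others are zero on both sides.
    zeros⇒span : ∀ {f} → Zeros f (a ℕ.+ d) (n ℕ.+ a) → Span U (consecutive a d) f
    zeros⇒span {f} f-zeros = c , _ , coefˢ-window-ext a eq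
      where
      c : Fin d → Carrier
      c j = coefˢ f (a ℕ.+ toℕ j)
      eq : ∀ i → a ≤ i → i < n ℕ.+ a → coefˢ f i ≡ coefˢ (combination c (consecutive a d)) i
      eq i a≤i i<n+a with ℕ.<-≤-connex i (a ℕ.+ d)
      ... | inj₂ a+d≤i = trans (f-zeros i a+d≤i i<n+a) (sym (consecutive-zeros c i a+d≤i i<n+a))
      ... | inj₁ i<a+d = subst (λ m → coefˢ f m ≡ coefˢ (combination c (consecutive a d)) m) a+j≡i
                           (sym (coefˢ-consecutive c j))
        where
        i∸a<d : i ∸ a < d
        i∸a<d = ℕ.+-cancelˡ-< a _ _ (subst (_< a ℕ.+ d) (sym (ℕ.m+[n∸m]≡n a≤i)) i<a+d)
        j : Fin d
        j = Fin.fromℕ< i∸a<d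
        a+j≡i : a ℕ.+ toℕ j ≡ i
        a+j≡i = trans (cong (a ℕ.+_) (Fin.toℕ-fromℕ< i∸a<d)) (ℕ.m+[n∸m]≡n a≤i)

    consecutive-independent : LinearlyIndependent U (consecutive a d)
    consecutive-independent c _ eq j = trans (sym (coefˢ-consecutive c j))
      (trans (cong (λ f → coefˢ f (a ℕ.+ toℕ j)) eq) (coef-0 _))

  -- Twisted Gabidulin codes as solutions of coefficient equations

  module TwistedGabidulin {k-1 : ℕ} (k<n : suc k-1 < n) where
    k : ℕ
    k = suc k-1

    private
      k-1≤n : k-1 ≤ n
      k-1≤n = ℕ.≤-trans (ℕ.n≤1+n _) (ℕ.<⇒≤ k<n)

      0<n : 0 < n
      0<n = ℕ.<-trans (s≤s z≤n) k<n

    head-coefˢ : ∀ η i → coefˢ (𝓗-generators k s η zero) i ≡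
                 coefˢ x^[ s ℕ.* 0 ] i + η * coefˢ x^[ s ℕ.* k ] i
    head-coefˢ η i = trans (coef-+ _ _ _) (cong₂ _+_
      (cong (λ m → coefˢ x^[ m ] i) (sym (ℕ.*-zeroʳ s))) (coef-*ₗ η _ _))

    head-coefˢ-0 : ∀ η → coefˢ (𝓗-generators k s η zero) 0 ≡ 1#
    head-coefˢ-0 η = trans (head-coefˢ η 0) (trans
      (cong₂ (λ a b → a + η * b) (coefˢ-x^-≋ {0} {0} refl)
        (coefˢ-x^-≋̸ {0} {k} λ p → case ≋-< 0<n k<n p of λ ()))
      (trans (cong (1# +_) (zeroʳ η)) (+-identityʳ 1#)))

    head-coefˢ-k : ∀ η → coefˢ (𝓗-generators k s η zero) k ≡ η
    head-coefˢ-k η = trans (head-coefˢ η k) (trans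
      (cong₂ (λ a b → a + η * b)
        (coefˢ-x^-≋̸ {k} {0} λ p → case ≋-< k<n 0<n p of λ ())
        (coefˢ-x^-≋ {k} {k} refl))
      (trans (+-identityˡ _) (*-identityʳ η)))

    head-coefˢ-off : ∀ η {i} → i < n → i ≢ 0 → i ≢ k → coefˢ (𝓗-generators k s η zero) i ≡ 0#
    head-coefˢ-off η {i} i<n i≢0 i≢k = trans (head-coefˢ η i) (trans
      (cong₂ (λ a b → a + η * b)
        (coefˢ-x^-≋̸ {i} {0} λ p → i≢0 (≋-< i<n 0<n p))
        (coefˢ-x^-≋̸ {i} {k} λ p → i≢k (≋-< i<n k<n p)))
      (trans (+-identityˡ _) (zeroʳ η)))

    module _ (η : Carrier) (c : Fin k → Carrier) where
      private
        tail : 𝓛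
        tail = combination (c ∘ suc) (consecutive 1 k-1)

        split : ∀ i → coefˢ (combination c (𝓗-generators k s η)) i ≡
                c zero * coefˢ (𝓗-generators k s η zero) i + coefˢ tail i
        split i = trans (coef-+ _ tail _) (cong (_+ coefˢ tail i) (coef-*ₗ (c zero) _ _))

        tail-0 : ∀ i → k ≤ i → i < suc n → coefˢ tail i ≡ 0#
        tail-0 i k≤i i<1+n = consecutive-zeros k-1≤n (c ∘ suc) i k≤i
          (subst (i <_) (sym (ℕ.+-comm n 1)) i<1+n)

      combination-coefˢ-0 : coefˢ (combination c (𝓗-generators k s η)) 0 ≡ c zero
      combination-coefˢ-0 = trans (split 0) (trans
        (cong₂ (λ a b → c zero * a + b) (head-coefˢ-0 η)
          -- Position 0 is read as position `n`, which lies at the very end of the interval where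
          -- the tail vanishes.
          (trans (sym (trans (cong (coefˢ tail) (sym (ℕ.+-identityʳ n))) (coefˢ-+n tail 0)))
            (tail-0 n (ℕ.<⇒≤ k<n) (ℕ.n<1+n n))))
        (trans (+-identityʳ _) (*-identityʳ _)))

      combination-coefˢ-suc : ∀ j → coefˢ (combination c (𝓗-generators k s η)) (suc (toℕ j)) ≡ c (suc j)
      combination-coefˢ-suc j = trans (split (suc (toℕ j))) (trans
        (cong₂ (λ a b → c zero * a + b)
          (head-coefˢ-off η (ℕ.<-trans j<k k<n) (λ ()) (ℕ.<⇒≢ j<k))
          (coefˢ-consecutive k-1≤n (c ∘ suc) j))
        (trans (cong (_+ c (suc j)) (zeroʳ _)) (+-identityˡ _)))
        where
        j<k : suc (toℕ j) < k
        j<k = s≤s (Fin.toℕ<n j)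

      combination-coefˢ-k : coefˢ (combination c (𝓗-generators k s η)) k ≡ η * c zero
      combination-coefˢ-k = trans (split k) (trans
        (cong₂ (λ a b → c zero * a + b) (head-coefˢ-k η) (tail-0 k ℕ.≤-refl (ℕ.<-trans k<n (ℕ.n<1+n n))))
        (trans (+-identityʳ _) (*-comm (c zero) η)))

      combination-coefˢ-off : Zeros (combination c (𝓗-generators k s η)) (suc k) n
      combination-coefˢ-off i k<i i<n = trans (split i) (trans
        (cong₂ (λ a b → c zero * a + b)
          (head-coefˢ-off η i<n (λ { refl → case k<i of λ () }) (ℕ.<⇒≢ k<i ∘ sym))
          (tail-0 i (ℕ.<⇒≤ k<i) (ℕ.<-trans i<n (ℕ.n<1+n n))))
        (trans (+-identityʳ _) (zeroʳ _)))

    generators-injective : ∀ η c c′ → combination c (𝓗-generators k s η) ≡ combination c′ (𝓗-generators k s η) →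
                           ∀ i → c i ≡ c′ i
    generators-injective η c c′ eq zero = trans (sym (combination-coefˢ-0 η c))
      (trans (cong (λ f → coefˢ f 0) eq) (combination-coefˢ-0 η c′))
    generators-injective η c c′ eq (suc j) = trans (sym (combination-coefˢ-suc η c j))
      (trans (cong (λ f → coefˢ f (suc (toℕ j))) eq) (combination-coefˢ-suc η c′ j))

    record In𝓗 (η : Carrier) (f : 𝓛) : Set where
      constructor in𝓗
      field
        twist : coefˢ f k ≡ η * coefˢ f 0
        zeros : Zeros f (suc k) n

    open In𝓗 public

    𝓗⇒In𝓗 : ∀ {η f} → f ∈ 𝓗 k s η → In𝓗 η f
    𝓗⇒In𝓗 {η} (c , _ , refl) = in𝓗
      (trans (combination-coefˢ-k η c) (cong (η *_) (sym (combination-coefˢ-0 η c))))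
      (combination-coefˢ-off η c)

    In𝓗⇒𝓗 : ∀ {η f} → In𝓗 η f → f ∈ 𝓗 k s η
    In𝓗⇒𝓗 {η} {f} f∈ = c , _ , coefˢ-ext eq
      where
      c : Fin k → Carrier
      c j = coefˢ f (toℕ j)
      eq : ∀ i → i < n → coefˢ f i ≡ coefˢ (combination c (𝓗-generators k s η)) i
      eq zero    _   = sym (combination-coefˢ-0 η c)
      eq (suc i) i<n with ℕ.<-cmp i k-1
      ... | tri≈ _ refl _ = trans (twist f∈) (sym (combination-coefˢ-k η c))
      ... | tri> _ _ k<i  = trans (zeros f∈ _ (s≤s k<i) i<n) (sym (combination-coefˢ-off η c _ (s≤s k<i) i<n))
      ... | tri< i<k _ _  = subst (λ m → coefˢ f (suc m) ≡ coefˢ (combination c (𝓗-generators k s η)) (suc m))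
        (Fin.toℕ-fromℕ< i<k) (sym (combination-coefˢ-suc η c (Fin.fromℕ< i<k)))

    In𝓗-*ₗ : ∀ {η f} a → In𝓗 η f → In𝓗 η (a *ₗ f)
    In𝓗-*ₗ {η} {f} a f∈ = in𝓗
      (begin
        coefˢ (a *ₗ f) k          ≡⟨ coef-*ₗ a f _ ⟩
        a * coefˢ f k             ≡⟨ cong (a *_) (twist f∈) ⟩
        a * (η * coefˢ f 0)       ≡⟨ *-assoc a η _ ⟨
        a * η * coefˢ f 0         ≡⟨ cong (_* coefˢ f 0) (*-comm a η) ⟩
        η * a * coefˢ f 0         ≡⟨ *-assoc η a _ ⟩
        η * (a * coefˢ f 0)       ≡⟨ cong (η *_) (coef-*ₗ a f _) ⟨
        η * coefˢ (a *ₗ f) 0      ∎)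
      λ i k<i i<n → trans (coef-*ₗ a f _) (trans (cong (a *_) (zeros f∈ i k<i i<n)) (zeroʳ a))

    In𝓗-map : ∀ {η f σ} → Endomorphism σ → In𝓗 η f → In𝓗 (σ η) (map σ f)
    In𝓗-map {η} {f} {σ} σ-hom f∈ = in𝓗
      (trans (coef-map σ f _) (trans (cong σ (twist f∈))
        (trans (Endomorphism.*-homo σ-hom η _) (cong (σ η *_) (sym (coef-map σ f _))))))
      λ i k<i i<n → trans (coef-map σ f _) (trans (cong σ (zeros f∈ i k<i i<n)) (Endomorphism.0-homo σ-hom))

    -- The left idealiser of a twisted Gabidulin code

    module LeftIdealiser (2<k : 2 < k) (k+2≤n : k ℕ.+ 2 ≤ n) {η : Carrier} (η≢0 : η ≢ 0#) (u : 𝓛)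
                         (u-idealises : ∀ {f} → In𝓗 η f → In𝓗 η (u ∘ᴸ f)) where
      private
        shifted : ∀ j → 1 ≤ j → j < k → In𝓗 η (u ∘ᴸ x^[ s ℕ.* j ])
        shifted j 1≤j j<k = u-idealises (in𝓗
          (trans (coefˢ-x^-≋̸ λ p → ℕ.<⇒≢ j<k (sym (≋-< k<n (ℕ.<-trans j<k k<n) p)))
            (sym (trans (cong (η *_) (coefˢ-x^-≋̸ λ p → ℕ.<⇒≢ 1≤j (≋-< 0<n (ℕ.<-trans j<k k<n) p))) (zeroʳ η))))
          λ i k<i i<n → coefˢ-x^-≋̸ λ p →
            ℕ.<⇒≢ (ℕ.<-trans j<k k<i) (sym (≋-< i<n (ℕ.<-trans j<k k<n) p)))

        -- Composing with `x^[ s * j ]` moves the coefficient at `i` to `i + j`, where membership in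
        -- the code allows no term.
        gap : ∀ i j → 1 ≤ j → j < k → k < i ℕ.+ j → i ℕ.+ j < n → coefˢ u i ≡ 0#
        gap i j 1≤j j<k k<i+j i+j<n = trans (sym (coefˢ-∘-x^ u j i)) (zeros (shifted j 1≤j j<k) _ k<i+j i+j<n)

        1+k<n : suc k < n
        1+k<n = subst (_≤ n) (ℕ.+-comm k 2) k+2≤n

        1<k : 1 < k
        1<k = ℕ.<-trans (s≤s (s≤s z≤n)) 2<k

        middle : ∀ i → 2 ≤ i → suc i < n → coefˢ u i ≡ 0#
        middle i 2≤i 1+i<n with ℕ.<-≤-connex i k
        ... | inj₂ k≤i = gap i 1 ℕ.≤-refl 1<k
          (subst (k <_) (ℕ.+-comm 1 i) (s≤s k≤i)) (subst (_< n) (ℕ.+-comm 1 i) 1+i<n)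
        -- The shift is chosen to land on `suc k`, the first place of the gap, which is below `n`
        -- because `k + 2 ≤ n`. The bound `2 ≤ i` keeps `j` below `k`.
        ... | inj₁ i<k = gap i j (ℕ.m<n⇒0<n∸m (ℕ.<-trans i<k (ℕ.n<1+n k)))
          (ℕ.∸-monoʳ-< {suc k} {i} {1} 2≤i (ℕ.≤-trans (ℕ.<⇒≤ i<k) (ℕ.n≤1+n k)))
          (subst (k <_) (sym i+j≡1+k) ℕ.≤-refl) (subst (_< n) (sym i+j≡1+k) 1+k<n)
          where
          j : ℕ
          j = suc k ∸ i
          i+j≡1+k : i ℕ.+ j ≡ suc k
          i+j≡1+k = ℕ.m+[n∸m]≡n (ℕ.≤-trans (ℕ.<⇒≤ i<k) (ℕ.n≤1+n k))

        wrap : ∀ i j → i ℕ.+ j ≡ n → coefˢ (u ∘ᴸ x^[ s ℕ.* j ]) 0 ≡ coefˢ u i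
        wrap i j i+j≡n = trans (sym (coefˢ-+n _ 0))
          (trans (cong (coefˢ _) (trans (ℕ.+-identityʳ n) (sym i+j≡n))) (coefˢ-∘-x^ u j i))

        -- Shifting by `k - 1` puts this coefficient at position `k`, so the twist equation makes it
        -- `η` times the coefficient that arrives at 0. That one comes from `n ∸ k-1`, a middle
        -- place since `2 < k`.
        one : coefˢ u 1 ≡ 0#
        one = begin
          coefˢ u 1                                     ≡⟨ coefˢ-∘-x^ u k-1 1 ⟨
          coefˢ (u ∘ᴸ x^[ s ℕ.* k-1 ]) k                ≡⟨ twist (shifted k-1 (ℕ.≤-pred 1<k) ℕ.≤-refl) ⟩
          η * coefˢ (u ∘ᴸ x^[ s ℕ.* k-1 ]) 0            ≡⟨ cong (η *_) (wrap (n ∸ k-1) k-1 (ℕ.m∸n+n≡m k-1≤n)) ⟩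
          η * coefˢ u (n ∸ k-1)                         ≡⟨ cong (η *_) (middle (n ∸ k-1)
            (ℕ.m+n≤o⇒m≤o∸n 2 (ℕ.≤-trans (ℕ.n≤1+n _) 1+k<n))
            (subst (suc (n ∸ k-1) <_) (ℕ.m+[n∸m]≡n 0<n) (s≤s (ℕ.∸-monoʳ-< {n} (ℕ.≤-pred 2<k) k-1≤n)))) ⟩
          η * 0#                                        ≡⟨ zeroʳ η ⟩
          0#                                            ∎

        -- Shifting by 1 puts this coefficient at position 0 and the one at `k - 1` at position `k`.
        -- The latter is a middle place, so the twist equation leaves `η` times the former equal to
        -- zero.
        last : coefˢ u (n ∸ 1) ≡ 0#
        last = x*y≡0⇒y≡0 η≢0 (begin
          η * coefˢ u (n ∸ 1)                     ≡⟨ cong (η *_) (wrap (n ∸ 1) 1 (ℕ.m∸n+n≡m 0<n)) ⟨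
          η * coefˢ (u ∘ᴸ x^[ s ℕ.* 1 ]) 0        ≡⟨ twist (shifted 1 ℕ.≤-refl 1<k) ⟨
          coefˢ (u ∘ᴸ x^[ s ℕ.* 1 ]) k            ≡⟨ cong (coefˢ _) (ℕ.+-comm 1 k-1) ⟩
          coefˢ (u ∘ᴸ x^[ s ℕ.* 1 ]) (k-1 ℕ.+ 1)  ≡⟨ coefˢ-∘-x^ u 1 k-1 ⟩
          coefˢ u k-1                             ≡⟨ middle k-1 (ℕ.≤-pred 2<k) k<n ⟩
          0#                                      ∎)

        nonconstant : ∀ i → i < n → i ≢ 0 → coefˢ u i ≡ 0#
        nonconstant 0               i<n i≢0 = contradiction refl i≢0
        nonconstant 1               i<n i≢0 = one
        nonconstant i@(suc (suc _)) i<n i≢0 with ℕ.m≤n⇒m<n∨m≡n i<n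
        ... | inj₁ 1+i<n = middle i (s≤s (s≤s z≤n)) 1+i<n
        ... | inj₂ refl  = last

      idealiser-scalar : u ≡ monomial (coef u 0) 0
      idealiser-scalar = coefˢ-ext λ i i<n → case i ℕ.≟ 0 of λ where
        (yes refl) → trans (coef-≋ u (cong (_% n) (ℕ.*-zeroʳ s)))
          (sym (coef-monomial-≋ _ (cong (_% n) (ℕ.*-zeroʳ s))))
        (no i≢0)   → trans (nonconstant i i<n i≢0)
          (sym (coef-monomial-≋̸ _ λ p → i≢0 (≋-< i<n 0<n (s*-≋⁻¹ (trans p (cong (_% n) (sym (ℕ.*-zeroʳ s))))))))

    -- Shifts of a twisted Gabidulin code and their intersections

    record InShift (η : Carrier) (j : ℕ) (f : 𝓛) : Set where
      constructor inShift
      field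
        twistʲ : coefˢ f (k ℕ.+ j) ≡ η ^[ s ℕ.* j ] * coefˢ f j
        zerosʲ : Zeros f (suc k ℕ.+ j) (n ℕ.+ j)

    open InShift public

    shift⇒InShift : ∀ {η j g} → g ∈ (𝓗 k s η ^ᶜ[ s ℕ.* j ]) → InShift η j g
    shift⇒InShift {η} {j} (f , f∈𝓗 , refl) = inShift
      (begin
        coefˢ (x^[ s ℕ.* j ] ∘ᴸ f) (k ℕ.+ j)         ≡⟨ coefˢ-x^-∘ f j k ⟩
        coefˢ f k ^[ s ℕ.* j ]                       ≡⟨ cong (_^[ s ℕ.* j ]) (twist f∈) ⟩
        (η * coefˢ f 0) ^[ s ℕ.* j ]                 ≡⟨ frobenius-* (s ℕ.* j) η _ ⟩
        η ^[ s ℕ.* j ] * coefˢ f 0 ^[ s ℕ.* j ]      ≡⟨ cong (η ^[ s ℕ.* j ] *_) (coefˢ-x^-∘ f j 0) ⟨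
        η ^[ s ℕ.* j ] * coefˢ (x^[ s ℕ.* j ] ∘ᴸ f) j ∎)
      λ i k+j<i i<n+j → case ℕ.m≤n⇒∃[o]m+o≡n (ℕ.≤-trans (ℕ.m≤n+m j (suc k)) k+j<i) of λ where
        (i′ , refl) → trans (cong (coefˢ _) (ℕ.+-comm j i′)) (trans (coefˢ-x^-∘ f j i′)
          (trans (cong (_^[ s ℕ.* j ]) (zeros f∈ i′
              (ℕ.+-cancelʳ-≤ j _ _ (subst (suc k ℕ.+ j ≤_) (ℕ.+-comm j i′) k+j<i))
              (ℕ.+-cancelʳ-< j _ _ (subst (_< n ℕ.+ j) (ℕ.+-comm j i′) i<n+j))))
            (frobenius-0 (s ℕ.* j))))
      where
      f∈ : In𝓗 η f
      f∈ = 𝓗⇒In𝓗 f∈𝓗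

    -- The shift is undone by composing with `x^[ s * j⁻ ]`, where `j⁻` stands for `-j` modulo `n`;
    -- the Frobenius power carried by `η` cancels at the same time.
    InShift⇒shift : ∀ {η j g} → InShift η j g → g ∈ (𝓗 k s η ^ᶜ[ s ℕ.* j ])
    InShift⇒shift {η} {j} {g} g∈ = f , In𝓗⇒𝓗 f∈ , sym (begin
      x^[ s ℕ.* j ] ∘ᴸ (x^[ s ℕ.* j⁻ ] ∘ᴸ g)     ≡⟨ ∘-assoc x^[ s ℕ.* j ] x^[ s ℕ.* j⁻ ] g ⟨
      (x^[ s ℕ.* j ] ∘ᴸ x^[ s ℕ.* j⁻ ]) ∘ᴸ g     ≡⟨ cong (_∘ᴸ g) (x^-∘-x^ (s ℕ.* j) (s ℕ.* j⁻)) ⟩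
      x^[ s ℕ.* j ℕ.+ s ℕ.* j⁻ ] ∘ᴸ g            ≡⟨ cong (_∘ᴸ g) (monomial-≋ 1# sj+sj⁻≋0) ⟩
      x^[ 0 ] ∘ᴸ g                               ≡⟨ ∘-identityˡ g ⟩
      g                                          ∎)
      where
      j⁻ : ℕ
      j⁻ = j ℕ.* (n ∸ 1)
      f : 𝓛
      f = x^[ s ℕ.* j⁻ ] ∘ᴸ g
      sj+sj⁻≋0 : s ℕ.* j ℕ.+ s ℕ.* j⁻ ≋ 0
      sj+sj⁻≋0 = trans (cong (λ r → (s ℕ.* j ℕ.+ r) % n) (sym (ℕ.*-assoc s j (n ∸ 1)))) (≋-inverse 0 (s ℕ.* j))
      coefˢ-f : ∀ m → coefˢ f m ≡ coefˢ g (m ℕ.+ j) ^[ s ℕ.* j⁻ ]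
      coefˢ-f m = trans (coefˢ-≋ f (sym (≋-inverse m j))) (coefˢ-x^-∘ g j⁻ (m ℕ.+ j))
      f∈ : In𝓗 η f
      f∈ = in𝓗
        (begin
          coefˢ f k                                                 ≡⟨ coefˢ-f k ⟩
          coefˢ g (k ℕ.+ j) ^[ s ℕ.* j⁻ ]                           ≡⟨ cong (_^[ s ℕ.* j⁻ ]) (twistʲ g∈) ⟩
          (η ^[ s ℕ.* j ] * coefˢ g j) ^[ s ℕ.* j⁻ ]                ≡⟨ frobenius-* (s ℕ.* j⁻) _ _ ⟩
          η ^[ s ℕ.* j ] ^[ s ℕ.* j⁻ ] * coefˢ g j ^[ s ℕ.* j⁻ ]
            ≡⟨ cong₂ _*_ (trans (frobenius-frobenius (s ℕ.* j) (s ℕ.* j⁻) η)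
                 (trans (frobenius-≋ sj+sj⁻≋0 η) (frobenius-zero η))) (sym (coefˢ-f 0)) ⟩
          η * coefˢ f 0                                             ∎)
        λ i k<i i<n → trans (coefˢ-f i) (trans
          (cong (_^[ s ℕ.* j⁻ ]) (zerosʲ g∈ (i ℕ.+ j) (ℕ.+-monoˡ-≤ j k<i) (ℕ.+-monoˡ-< j i<n)))
          (frobenius-0 (s ℕ.* j⁻)))

    Zeros-extend : ∀ {f hi} → Zeros f k hi → coefˢ f hi ≡ 0# → Zeros f k (suc hi)
    Zeros-extend f-zeros f-hi i k≤i i<1+hi with ℕ.m≤n⇒m<n∨m≡n (ℕ.≤-pred i<1+hi)
    ... | inj₁ i<hi = f-zeros i k≤i i<hi
    ... | inj₂ refl = f-hi

    -- Position `k + j` already lies in the zero interval, so the twist equation of the shift gives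
    -- a nonzero multiple of the coefficient at `j` equal to zero. Read as position `n + j`, this is
    -- the next place of the interval.
    zeros-step : ∀ {η j f} → η ≢ 0# → InShift η j f → Zeros f k (n ℕ.+ j) → Zeros f k (suc (n ℕ.+ j))
    zeros-step {η} {j} {f} η≢0 f∈ f-zeros = Zeros-extend f-zeros
      (trans (coefˢ-+n f j) (x*y≡0⇒y≡0 (frobenius-nonZero (s ℕ.* j) η≢0)
        (trans (sym (twistʲ f∈)) (f-zeros (k ℕ.+ j) (ℕ.m≤m+n k j) (ℕ.+-monoˡ-< j k<n)))))

    -- The zeros of the shifted code start at `k + 2` and reach position `n`, that is, position 0.
    -- The unshifted twist equation then kills position `k`, and its zeros supply `k + 1`, the only
    -- place still missing.
    zeros-base : ∀ {η f} → suc k < n → In𝓗 η f → InShift η 1 f → Zeros f k (n ℕ.+ 1)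
    zeros-base {η} {f} 1+k<n f∈ f∈₁ i k≤i i<n+1 with ℕ.m≤n⇒m<n∨m≡n k≤i
    ... | inj₂ refl = trans (twist f∈) (trans (cong (η *_) f0) (zeroʳ η))
      where
      f0 : coefˢ f 0 ≡ 0#
      f0 = trans (sym (coefˢ-+n f 0)) (zerosʲ f∈₁ (n ℕ.+ 0)
        (subst₂ _≤_ (ℕ.+-comm 1 (suc k)) (sym (ℕ.+-identityʳ n)) 1+k<n)
        (ℕ.+-monoʳ-< n (s≤s z≤n)))
    ... | inj₁ k<i with ℕ.m≤n⇒m<n∨m≡n k<i
    ...   | inj₂ refl  = zeros f∈ _ ℕ.≤-refl 1+k<n
    ...   | inj₁ 1+k<i = zerosʲ f∈₁ i (subst (_≤ i) (ℕ.+-comm 1 (suc k)) 1+k<i) i<n+1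

    -- For `j < a` the zero interval contains every position that the equations of the `j`-th shift
    -- mention, including both sides of the twist, the coefficient at `j` being the one at `n + j`.
    zeros⇒InShift : ∀ {η a j f} → j < a → Zeros f k (n ℕ.+ a) → InShift η j f
    zeros⇒InShift {η} {a} {j} {f} j<a f-zeros = inShift
      (trans (f-zeros (k ℕ.+ j) (ℕ.m≤m+n k j) (ℕ.+-mono-< k<n j<a))
        (sym (trans (cong (η ^[ s ℕ.* j ] *_)
          (trans (sym (coefˢ-+n f j)) (f-zeros (n ℕ.+ j) (ℕ.≤-trans (ℕ.<⇒≤ k<n) (ℕ.m≤m+n n j)) (ℕ.+-monoʳ-< n j<a))))
          (zeroʳ _))))
      λ i k+j<i i<n+j → f-zeros i (ℕ.≤-trans (ℕ.≤-trans (ℕ.n≤1+n k) (ℕ.m≤m+n (suc k) j)) k+j<i)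
        (ℕ.<-trans i<n+j (ℕ.+-monoʳ-< n j<a))

    zeros⇒In𝓗 : ∀ {η a f} → 0 < a → Zeros f k (n ℕ.+ a) → In𝓗 η f
    zeros⇒In𝓗 {η} {a} {f} 0<a f-zeros = in𝓗
      (trans (f-zeros k ℕ.≤-refl (ℕ.<-≤-trans k<n (ℕ.m≤m+n n a)))
        (sym (trans (cong (η *_) (trans (sym (coefˢ-+n f 0))
          (f-zeros (n ℕ.+ 0) (ℕ.≤-trans (ℕ.<⇒≤ k<n) (ℕ.m≤m+n n 0)) (ℕ.+-monoʳ-< n 0<a)))) (zeroʳ η))))
      λ i k<i i<n → f-zeros i (ℕ.<⇒≤ k<i) (ℕ.<-≤-trans i<n (ℕ.m≤m+n n a))

-- Counting, and equivalence of codes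

open import Data.Nat.GCD using (gcd; module Bézout)
open import Relation.Unary using (Pred; U; _∈_; _∩_; _≐_)
open import Relation.Nullary.Decidable using (¬?)
open import Algebra.Morphism.Structures using (module RingMorphisms)
import Algebra.Morphism.Construct.Identity as Identity
open import Function.Bundles using (_⇔_; mk⇔)
funToFin-cong : ∀ {m N} {f g : Fin m → Fin N} → (∀ i → f i ≡ g i) → Fin.funToFin f ≡ Fin.funToFin g
funToFin-cong {zero}  eq = refl
funToFin-cong {suc m} eq = cong₂ Fin.combine (eq zero) (funToFin-cong (eq ∘ suc))

funToFin-injective : ∀ {m N} (f g : Fin m → Fin N) → Fin.funToFin f ≡ Fin.funToFin g → ∀ i → f i ≡ g i
funToFin-injective f g eq i = trans (sym (Fin.finToFun-funToFin f i))
  (trans (cong (λ x → Fin.finToFun x i) eq) (Fin.finToFun-funToFin g i))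

finToFun-injective : ∀ {m N} (x y : Fin (N ℕ.^ m)) →
                     (∀ i → Fin.finToFun {N} {m} x i ≡ Fin.finToFun y i) → x ≡ y
finToFun-injective {m} {N} x y eq = trans (sym (Fin.funToFin-finToFin {m} {N} x))
  (trans (funToFin-cong eq) (Fin.funToFin-finToFin {m} {N} y))

module Codes (q n : ℕ) .{{_ : NonZero n}} (q-primePower : IsPrimePower q)
             (F : FiniteField (q ℕ.^ n)) where
  open LinearizedPolynomials q n q-primePower F

  private
    open Inverse enumeration using (strictlyInverseˡ; strictlyInverseʳ) renaming (to to index; from to element)

    1<∣F∣ : 1 < q ℕ.^ n
    1<∣F∣ = ℕ.^-monoʳ-< q 1<q (ℕ.>-nonZero⁻¹ n)

  -- Coordinate vectors are encoded as elements of finite sets of sizes `(q ^ n) ^ a` and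
  -- `(q ^ n) ^ b`. The map `g` may be any injection, with no linearity, which is what equivalences
  -- provide; vectors are compared pointwise.
  injection⇒≤ : ∀ {a b} (g : (Fin a → Carrier) → (Fin b → Carrier)) →
    (∀ c c′ → (∀ i → g c i ≡ g c′ i) → ∀ i → c i ≡ c′ i) → a ≤ b
  injection⇒≤ {a} {b} g g-injective = ℕ.≮⇒≥ λ b<a →
    ℕ.<⇒≱ (ℕ.^-monoʳ-< (q ℕ.^ n) 1<∣F∣ b<a) (Fin.injective⇒≤ {f = code} λ {x} {y} → code-injective x y)
    where
    vector : Fin ((q ℕ.^ n) ℕ.^ a) → Fin a → Carrier
    vector x = element ∘ Fin.finToFun x
    code : Fin ((q ℕ.^ n) ℕ.^ a) → Fin ((q ℕ.^ n) ℕ.^ b)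
    code x = Fin.funToFin (index ∘ g (vector x))
    code-injective : ∀ x y → code x ≡ code y → x ≡ y
    code-injective x y eq = finToFun-injective {a} x y λ i →
      trans (sym (strictlyInverseˡ _)) (trans (cong index (vectors-agree i)) (strictlyInverseˡ _))
      where
      vectors-agree : ∀ i → vector x i ≡ vector y i
      vectors-agree = g-injective (vector x) (vector y) λ i →
        trans (sym (strictlyInverseʳ _)) (trans
          (cong element (funToFin-injective (index ∘ g (vector x)) (index ∘ g (vector y)) eq i))
          (strictlyInverseʳ _))

  combination-+ : ∀ {d} c c′ (b : Fin d → 𝓛) →
                  combination (λ i → c i + c′ i) b ≡ combination c b +ᴹ combination c′ b
  combination-+ c c′ b = trans
    (∑ᴹ.sum-cong-≗ {x = λ i → (c i + c′ i) *ₗ b i} {λ i → c i *ₗ b i +ᴹ c′ i *ₗ b i} λ i → coef-ext λ m →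
      trans (coef-*ₗ _ (b i) m) (trans (distribʳ _ _ _)
        (sym (trans (coef-+ _ _ m) (cong₂ _+_ (coef-*ₗ (c i) (b i) m) (coef-*ₗ (c′ i) (b i) m))))))
    (∑ᴹ.∑-distrib-+ (λ i → c i *ₗ b i) (λ i → c′ i *ₗ b i))

  combination-zero : ∀ {d} c (b : Fin d → 𝓛) → (∀ i → c i ≡ 0#) → combination c b ≡ 0ᴹ
  combination-zero c b c≡0 = ∑ᴹ.sum-ε (λ i → c i *ₗ b i) λ i → trans (cong (_*ₗ b i) (c≡0 i)) (0#-*ₗ (b i))

  combination-injective : ∀ {d} {b : Fin d → 𝓛} → LinearlyIndependent U b →
    ∀ c c′ → combination c b ≡ combination c′ b → ∀ i → c i ≡ c′ i
  combination-injective {b = b} b-independent c c′ eq i = x-y≡0⇒x≡y (b-independent (λ i → c i - c′ i) _ (begin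
    combination (λ i → c i - c′ i) b                    ≡⟨ combination-+ c (λ i → - c′ i) b ⟩
    combination c b +ᴹ combination (λ i → - c′ i) b     ≡⟨ cong (_+ᴹ combination (λ i → - c′ i) b) eq ⟩
    combination c′ b +ᴹ combination (λ i → - c′ i) b    ≡⟨ combination-+ c′ (λ i → - c′ i) b ⟨
    combination (λ i → c′ i - c′ i) b                   ≡⟨ combination-zero _ b (λ i → -‿inverseʳ (c′ i)) ⟩
    0ᴹ                                                  ∎) i)

  ∘-cancelʳ : ∀ p → Invertible p → ∀ f g → f ∘ᴸ p ≡ g ∘ᴸ p → f ≡ g
  ∘-cancelʳ p (p⁻¹ , pp⁻¹≡1 , _) f g eq = trans (sym (undo f)) (trans (cong (_∘ᴸ p⁻¹) eq) (undo g))
    where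
    undo : ∀ f → (f ∘ᴸ p) ∘ᴸ p⁻¹ ≡ f
    undo f = trans (∘-assoc f p p⁻¹) (trans (cong (f ∘ᴸ_) pp⁻¹≡1) (∘-identityʳ f))

  ∘-cancelˡ : ∀ p → Invertible p → ∀ f g → p ∘ᴸ f ≡ p ∘ᴸ g → f ≡ g
  ∘-cancelˡ p (p⁻¹ , _ , p⁻¹p≡1) f g eq = trans (sym (undo f)) (trans (cong (p⁻¹ ∘ᴸ_) eq) (undo g))
    where
    undo : ∀ f → p⁻¹ ∘ᴸ (p ∘ᴸ f) ≡ f
    undo f = trans (sym (∘-assoc p⁻¹ p f)) (trans (cong (_∘ᴸ f) p⁻¹p≡1) (∘-identityˡ f))

  private
    ∘-undo : ∀ {f f⁻¹ g g⁻¹} → f ∘ᴸ f⁻¹ ≡ x^[ 0 ] → g ∘ᴸ g⁻¹ ≡ x^[ 0 ] → (f ∘ᴸ g) ∘ᴸ (g⁻¹ ∘ᴸ f⁻¹) ≡ x^[ 0 ]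
    ∘-undo {f} {f⁻¹} {g} {g⁻¹} f-inv g-inv = begin
      (f ∘ᴸ g) ∘ᴸ (g⁻¹ ∘ᴸ f⁻¹)   ≡⟨ ∘-assoc f g (g⁻¹ ∘ᴸ f⁻¹) ⟩
      f ∘ᴸ g ∘ᴸ g⁻¹ ∘ᴸ f⁻¹       ≡⟨ cong (f ∘ᴸ_) (∘-assoc g g⁻¹ f⁻¹) ⟨
      f ∘ᴸ (g ∘ᴸ g⁻¹) ∘ᴸ f⁻¹     ≡⟨ cong (λ h → f ∘ᴸ h ∘ᴸ f⁻¹) g-inv ⟩
      f ∘ᴸ x^[ 0 ] ∘ᴸ f⁻¹        ≡⟨ cong (f ∘ᴸ_) (∘-identityˡ f⁻¹) ⟩
      f ∘ᴸ f⁻¹                   ≡⟨ f-inv ⟩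
      x^[ 0 ]                    ∎

  ∘-invertible : ∀ f g → Invertible f → Invertible g → Invertible (f ∘ᴸ g)
  ∘-invertible f g (f⁻¹ , ff⁻¹ , f⁻¹f) (g⁻¹ , gg⁻¹ , g⁻¹g) =
    g⁻¹ ∘ᴸ f⁻¹ , ∘-undo {f} {f⁻¹} {g} {g⁻¹} ff⁻¹ gg⁻¹ , ∘-undo {g⁻¹} {g} {f⁻¹} {f} g⁻¹g f⁻¹f

  inverse-invertible : ∀ f (f-inv : Invertible f) → Invertible (proj₁ f-inv)
  inverse-invertible f (f⁻¹ , ff⁻¹ , f⁻¹f) = f , f⁻¹f , ff⁻¹

  x^[0]-invertible : Invertible x^[ 0 ]
  x^[0]-invertible = x^[ 0 ] , ∘-identityˡ x^[ 0 ] , ∘-identityˡ x^[ 0 ]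

  x^-invertible : ∀ i → Invertible x^[ i ]
  x^-invertible i = x^[ i ℕ.* (n ∸ 1) ] ,
    trans (x^-∘-x^ i _) (monomial-≋ 1# (≋-inverse 0 i)) ,
    trans (x^-∘-x^ _ i) (monomial-≋ 1# (trans (cong (_% n) (ℕ.+-comm _ i)) (≋-inverse 0 i)))

  map-invertible : ∀ {σ} → Endomorphism σ → ∀ f → Invertible f → Invertible (map σ f)
  map-invertible {σ} σ-hom f (f⁻¹ , ff⁻¹ , f⁻¹f) = map σ f⁻¹ ,
    trans (sym (Endomorphism.map-∘ σ-hom f f⁻¹)) (trans (cong (map σ) ff⁻¹) (Endomorphism.map-x^ σ-hom 0)) ,
    trans (sym (Endomorphism.map-∘ σ-hom f⁻¹ f)) (trans (cong (map σ) f⁻¹f) (Endomorphism.map-x^ σ-hom 0))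

  -- The inverse is kept as data together with its homomorphism laws, because the right factor `p`
  -- and the new `η` are obtained by applying it.
  record Automorphism : Set where
    field
      to from        : Carrier → Carrier
      to-hom         : Endomorphism to
      from-hom       : Endomorphism from
      to∘from        : ∀ x → to (from x) ≡ x
      from∘to        : ∀ x → from (to x) ≡ x

    map-from∘to : ∀ (f : 𝓛) → map from (map to f) ≡ f
    map-from∘to f = trans (sym (Vec.map-∘ from to f)) (trans (Vec.map-cong from∘to f) (Vec.map-id f))

  automorphism : ∀ {σ} → IsFieldAutomorphism σ → Automorphism
  automorphism {σ} σ-iso = record
    { to = σ ; from = σ⁻¹
    ; to-hom = record { +-homo = +-homo ; *-homo = *-homo ; 0-homo = 0#-homo ; 1-homo = 1#-homo }
    ; from-hom = record
      { +-homo = λ x y → injective (trans (σσ⁻¹ _) (sym (trans (+-homo _ _) (cong₂ _+_ (σσ⁻¹ x) (σσ⁻¹ y)))))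
      ; *-homo = λ x y → injective (trans (σσ⁻¹ _) (sym (trans (*-homo _ _) (cong₂ _*_ (σσ⁻¹ x) (σσ⁻¹ y)))))
      ; 0-homo = injective (trans (σσ⁻¹ _) (sym 0#-homo))
      ; 1-homo = injective (trans (σσ⁻¹ _) (sym 1#-homo)) }
    ; to∘from = σσ⁻¹
    ; from∘to = λ x → injective (σσ⁻¹ (σ x)) }
    where
    open RingMorphisms.IsRingIsomorphism σ-iso
    σ⁻¹ : Carrier → Carrier
    σ⁻¹ x = proj₁ (surjective x)
    σσ⁻¹ : ∀ x → σ (σ⁻¹ x) ≡ x
    σσ⁻¹ x = proj₂ (surjective x) refl

  endomorphism-∘ : ∀ {σ τ} → Endomorphism σ → Endomorphism τ → Endomorphism (σ ∘ τ)
  endomorphism-∘ {σ} σ-hom τ-hom = record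
    { +-homo = λ x y → trans (cong σ (T.+-homo x y)) (S.+-homo _ _)
    ; *-homo = λ x y → trans (cong σ (T.*-homo x y)) (S.*-homo _ _)
    ; 0-homo = trans (cong σ T.0-homo) S.0-homo
    ; 1-homo = trans (cong σ T.1-homo) S.1-homo }
    where
    module S = Endomorphism σ-hom
    module T = Endomorphism τ-hom

  _⊙_ : Automorphism → Automorphism → Automorphism
  σ ⊙ τ = record
    { to = S.to ∘ T.to ; from = T.from ∘ S.from
    ; to-hom = endomorphism-∘ S.to-hom T.to-hom ; from-hom = endomorphism-∘ T.from-hom S.from-hom
    ; to∘from = λ x → trans (cong S.to (T.to∘from _)) (S.to∘from x)
    ; from∘to = λ x → trans (cong T.from (S.from∘to _)) (T.from∘to x) }
    where
    module S = Automorphism σ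
    module T = Automorphism τ

  frobenius-automorphism : ℕ → Automorphism
  frobenius-automorphism i = record
    { to = _^[ i ] ; from = _^[ i⁻ ]
    ; to-hom = frobenius-endomorphism i ; from-hom = frobenius-endomorphism i⁻
    ; to∘from = λ x → trans (frobenius-frobenius i⁻ i x)
        (trans (frobenius-≋ (trans (cong (_% n) (ℕ.+-comm i⁻ i)) (≋-inverse 0 i)) x) (frobenius-zero x))
    ; from∘to = λ x → trans (frobenius-frobenius i i⁻ x)
        (trans (frobenius-≋ (≋-inverse 0 i) x) (frobenius-zero x)) }
    where
    i⁻ : ℕ
    i⁻ = i ℕ.* (n ∸ 1)

  record Equivalence (C D : Pred 𝓛 0ℓ) : Set where
    field
      h g          : 𝓛
      σ            : Automorphism
      h-invertible : Invertible h
      g-invertible : Invertible g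

    open Automorphism σ public

    transform : 𝓛 → 𝓛
    transform f = h ∘ᴸ map to f ∘ᴸ g

    field
      image    : ∀ {f} → f ∈ C → transform f ∈ D
      preimage : ∀ {φ} → φ ∈ D → ∃[ f ] f ∈ C × φ ≡ transform f

    transform-injective : ∀ {f f′} → transform f ≡ transform f′ → f ≡ f′
    transform-injective {f} {f′} eq = trans (sym (map-from∘to f))
      (trans (cong (map from) (∘-cancelʳ g g-invertible (map to f) (map to f′)
        (∘-cancelˡ h h-invertible (map to f ∘ᴸ g) (map to f′ ∘ᴸ g) eq))) (map-from∘to f′))

  equivalence : ∀ {C D} → Equivalent C D → Equivalence C D
  equivalence (h , g , σ , h-inv , g-inv , σ-iso , (image , preimage)) = record
    { h = h ; g = g ; σ = automorphism σ-iso ; h-invertible = h-inv ; g-invertible = g-inv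
    ; image = λ f∈C → image (_ , f∈C , refl) ; preimage = preimage }

  -- Applying the second automorphism to coefficients respects composition, so it distributes over
  -- the three factors of the first map; this explains the `map DE.to` on `CD.h` and `CD.g`.
  equivalence-trans : ∀ {C D E} → Equivalence C D → Equivalence D E → Equivalence C E
  equivalence-trans {C} {D} {E} CD DE = record
    { h = DE.h ∘ᴸ map DE.to CD.h ; g = map DE.to CD.g ∘ᴸ DE.g ; σ = DE.σ ⊙ CD.σ
    ; h-invertible = ∘-invertible DE.h (map DE.to CD.h) DE.h-invertible
        (map-invertible DE.to-hom CD.h CD.h-invertible)
    ; g-invertible = ∘-invertible (map DE.to CD.g) DE.g
        (map-invertible DE.to-hom CD.g CD.g-invertible) DE.g-invertible
    ; image = λ {f} f∈C → subst E (composite f) (DE.image (CD.image f∈C))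
    ; preimage = λ φ∈E → case DE.preimage φ∈E of λ where
        (ψ , ψ∈D , refl) → case CD.preimage ψ∈D of λ where
          (f , f∈C , refl) → f , f∈C , composite f }
    where
    module CD = Equivalence CD
    module DE = Equivalence DE
    composite : ∀ f → DE.transform (CD.transform f) ≡
      (DE.h ∘ᴸ map DE.to CD.h) ∘ᴸ map (DE.to ∘ CD.to) f ∘ᴸ map DE.to CD.g ∘ᴸ DE.g
    composite f = begin
      DE.h ∘ᴸ map DE.to (CD.h ∘ᴸ map CD.to f ∘ᴸ CD.g) ∘ᴸ DE.g
        ≡⟨ cong (λ φ → DE.h ∘ᴸ φ ∘ᴸ DE.g) (trans (Endomorphism.map-∘ DE.to-hom CD.h (map CD.to f ∘ᴸ CD.g))
             (cong (H ∘ᴸ_) (trans (Endomorphism.map-∘ DE.to-hom (map CD.to f) CD.g)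
               (cong (_∘ᴸ G) (sym (Vec.map-∘ DE.to CD.to f)))))) ⟩
      DE.h ∘ᴸ (H ∘ᴸ f′ ∘ᴸ G) ∘ᴸ DE.g      ≡⟨ cong (DE.h ∘ᴸ_) (∘-assoc H (f′ ∘ᴸ G) DE.g) ⟩
      DE.h ∘ᴸ H ∘ᴸ (f′ ∘ᴸ G) ∘ᴸ DE.g      ≡⟨ cong (λ φ → DE.h ∘ᴸ H ∘ᴸ φ) (∘-assoc f′ G DE.g) ⟩
      DE.h ∘ᴸ H ∘ᴸ f′ ∘ᴸ G ∘ᴸ DE.g        ≡⟨ ∘-assoc DE.h H (f′ ∘ᴸ G ∘ᴸ DE.g) ⟨
      (DE.h ∘ᴸ H) ∘ᴸ f′ ∘ᴸ G ∘ᴸ DE.g      ∎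
      where
      H G f′ : 𝓛
      H = map DE.to CD.h
      G = map DE.to CD.g
      f′ = map (DE.to ∘ CD.to) f

  equivalent-refl : ∀ C → Equivalent C C
  equivalent-refl C = x^[ 0 ] , x^[ 0 ] , id , x^[0]-invertible , x^[0]-invertible ,
    Identity.isRingIsomorphism rawRing refl ,
    (λ { (f , f∈C , refl) → subst C (sym (trivial f)) f∈C }) , λ {f} f∈C → f , f∈C , sym (trivial f)
    where
    trivial : ∀ f → x^[ 0 ] ∘ᴸ map id f ∘ᴸ x^[ 0 ] ≡ f
    trivial f = trans (∘-identityˡ (map id f ∘ᴸ x^[ 0 ])) (trans (∘-identityʳ (map id f)) (Vec.map-id f))

  -- Automorphisms commute with the norm and fix 1 and -1, so the inverse would carry a forbidden
  -- norm of the image back to a forbidden norm of `η`.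
  admissible-automorphism : ∀ (σ : Automorphism) k {η} → AdmissibleNorm k η →
                            AdmissibleNorm k (Automorphism.to σ η)
  admissible-automorphism σ k {η} admissible eq = admissible (begin
    norm η                            ≡⟨ cong norm (from∘to η) ⟨
    norm (from (to η))                ≡⟨ norm-homo (to η) ⟨
    from (norm (to η))                ≡⟨ cong from eq ⟩
    from ((- 1#) ^ (n ℕ.* k))         ≡⟨ ^-homo (- 1#) (n ℕ.* k) ⟩
    from (- 1#) ^ (n ℕ.* k)           ≡⟨ cong (_^ (n ℕ.* k)) (trans (neg-homo 1#) (cong -_ 1-homo)) ⟩
    (- 1#) ^ (n ℕ.* k)                ∎)
    where
    open Automorphism σ
    open Endomorphism from-hom

  module _ {C D : Pred 𝓛 0ℓ} (C≃D : Equivalence C D) where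
    open Equivalence C≃D

    -- Coordinates along `b` are sent to coordinates along `b′` of the transformed word. This
    -- assignment is injective since `transform` is, and so it bounds `d` by counting.
    span-dim≤ : ∀ {d e} {b : Fin d → 𝓛} {b′ : Fin e → 𝓛} →
      (∀ c → combination c b ∈ C) → (∀ c c′ → combination c b ≡ combination c′ b → ∀ i → c i ≡ c′ i) →
      (∀ {φ} → φ ∈ D → Span U b′ φ) → d ≤ e
    span-dim≤ {d} {e} {b} {b′} b∈C b-injective D-spanned = injection⇒≤ (proj₁ ∘ coordinates) λ c c′ eq →
      b-injective c c′ (transform-injective (trans (proj₂ (proj₂ (coordinates c)))
        (trans (combination-cong {b = b′} eq (λ _ → refl)) (sym (proj₂ (proj₂ (coordinates c′)))))))
      where
      coordinates : ∀ c → Span U b′ (transform (combination c b))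
      coordinates c = D-spanned (image (b∈C c))

    span-dim≥ : ∀ {d e} {b : Fin d → 𝓛} {b′ : Fin e → 𝓛} →
      (∀ {f} → f ∈ C → Span U b f) →
      (∀ c → combination c b′ ∈ D) → (∀ c c′ → combination c b′ ≡ combination c′ b′ → ∀ i → c i ≡ c′ i) → e ≤ d
    span-dim≥ {d} {e} {b} {b′} C-spanned b′∈D b′-injective = injection⇒≤ coordinates λ c c′ eq →
      b′-injective c c′ (trans (proj₂ (proj₂ (source c))) (trans (cong transform
        (trans (proj₂ (proj₂ (spanned c))) (trans (combination-cong {b = b} eq (λ _ → refl))
          (sym (proj₂ (proj₂ (spanned c′)))))))
        (sym (proj₂ (proj₂ (source c′))))))
      where
      source : ∀ c → ∃[ f ] f ∈ C × combination c b′ ≡ transform f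
      source c = preimage (b′∈D c)
      spanned : ∀ c → Span U b (proj₁ (source c))
      spanned c = C-spanned (proj₁ (proj₂ (source c)))
      coordinates : (Fin e → Carrier) → Fin d → Carrier
      coordinates c = proj₁ (spanned c)

  -- Both inequalities come from counting, because the equivalence need not be compatible with
  -- scalars.
  𝓗-dimension : ∀ {C k k′ s η} → HasDim U C k → k ℕ.+ 2 ≤ n → gcd s n ≡ 1 → 1 ≤ k′ → k′ ≤ n →
                Equivalence C (𝓗 k′ s η) → k′ ≡ k
  𝓗-dimension {C} {k} {suc k′-1} {s} {η} (b , b-independent , C⊆span , span⊆C) k+2≤n gcd≡1 _ k′≤n C≃𝓗 =
    ℕ.≤-antisym (case ℕ.m≤n⇒m<n∨m≡n k′≤n of λ where
      (inj₁ k′<n) → span-dim≥ C≃𝓗 {b = b} {𝓗-generators (suc k′-1) s η} C⊆span (λ c → c , _ , refl)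
        (TwistedGabidulin.generators-injective k′<n η)
      -- For `k′ = n` the exponent `s * k′` wraps to 0 and the first generator becomes a multiple of
      -- `x`. The other `n - 1` generators are independent in any case, and `n - 1 ≤ k` contradicts
      -- `k + 2 ≤ n`.
      (inj₂ refl) → contradiction
        (span-dim≥ C≃𝓗 {b = b} {consecutive 1 k′-1} C⊆span
          (λ c → (λ { zero → 0# ; (suc j) → c j }) , _ ,
            sym (trans (cong (_+ᴹ combination c (consecutive 1 k′-1)) (0#-*ₗ _)) (+ᴹ-identityˡ _)))
          (combination-injective (consecutive-independent {1} (ℕ.n≤1+n k′-1))))
        (ℕ.<⇒≱ (ℕ.≤-pred (subst (_≤ n) (ℕ.+-comm k 2) k+2≤n))))
      (span-dim≤ C≃𝓗 {b = b} {𝓗-generators (suc k′-1) s η} (λ c → span⊆C (c , _ , refl))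
        (combination-injective b-independent) id)
    where open CoprimeIndexing q n q-primePower F s gcd≡1

-- Codes of the form `𝓗 ∘ p`

module TwistedGabidulinCodes (q n : ℕ) .{{_ : NonZero n}} (q-primePower : IsPrimePower q)
                             (F : FiniteField (q ℕ.^ n)) where
  open LinearizedPolynomials q n q-primePower F
  open Codes q n q-primePower F

  *-cancelˡ-comm : ∀ a {b c} → a ≢ 0# → a * b ≡ c * a → b ≡ c
  *-cancelˡ-comm a {b} {c} a≢0 eq = *-cancelˡ-nonZero a a≢0 (trans eq (*-comm c a))

  -- A linearized polynomial that normalises the scalars has a single term,
  -- because distinct powers of the Frobenius automorphism are distinct maps.
  semilinear⇒monomial : ∀ h → Invertible h →
    (∀ a → ∃[ b ] (∀ i → coef h i * a ^[ i ] ≡ b * coef h i)) →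
    ∃[ c ] ∃[ i ] c ≢ 0# × h ≡ monomial c i
  semilinear⇒monomial h (h⁻¹ , hh⁻¹≡1 , _) semilinear
    with Fin.any? {n} (λ i → ¬? (coef h (toℕ i) ≟ᶠ 0#))
  ... | no h-zero = contradiction (trans (sym 1≡0) (coef-monomial-≋ 1# {0} refl)) 0≢1
    where
    h≡0 : h ≡ 0ᴹ
    h≡0 = coef-ext λ m → trans (coef-≋ h (sym (toℕ-mod-≋ m))) (trans (zero-at (m mod n)) (sym (coef-0 m)))
      where
      zero-at : ∀ i → coef h (toℕ i) ≡ 0#
      zero-at i with coef h (toℕ i) ≟ᶠ 0#
      ... | yes eq = eq
      ... | no neq = contradiction (i , neq) h-zero
    1≡0 : coef x^[ 0 ] 0 ≡ 0#
    1≡0 = trans (cong (λ f → coef f 0) (trans (sym hh⁻¹≡1)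
      (trans (cong (_∘ᴸ h⁻¹) h≡0) (Additive.0ᴹ-homo (∘-additiveˡ h⁻¹))))) (coef-0 0)
  ... | yes (i , hᵢ≢0) = coef h (toℕ i) , toℕ i , hᵢ≢0 , monomial-ext _ (toℕ i) h refl off
    where
    off : ∀ m → ¬ (m ≋ toℕ i) → coef h m ≡ 0#
    off m m≋̸i with coef h m ≟ᶠ 0#
    ... | yes eq  = eq
    ... | no hₘ≢0 = contradiction
      (cong (_% n) (frobenius-distinct (m%n<n m n) (Fin.toℕ<n i) same))
      (λ p → m≋̸i (trans (sym (%-≋ m)) p))
      where
      same : ∀ a → a ^[ m % n ] ≡ a ^[ toℕ i ]
      same a with semilinear a
      ... | b , eq = trans (frobenius-≋ (%-≋ m) a)
        (trans (*-cancelˡ-comm (coef h m) hₘ≢0 (eq m)) (sym (*-cancelˡ-comm (coef h (toℕ i)) hᵢ≢0 (eq (toℕ i)))))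

  module _ (s : ℕ) (gcd≡1 : gcd s n ≡ 1) {k-1 : ℕ} (2<k : 2 < suc k-1) (k+2≤n : suc k-1 ℕ.+ 2 ≤ n) where
    open CoprimeIndexing q n q-primePower F s gcd≡1

    k<n : suc k-1 < n
    k<n = ℕ.≤-trans (ℕ.n≤1+n _) (subst (_≤ n) (ℕ.+-comm (suc k-1) 2) k+2≤n)

    open TwistedGabidulin {k-1} k<n

    -- The normal form through which both implications pass: `C` is the set of all `φ ∘ p` with `φ`
    -- in the twisted Gabidulin code.
    record IsRightTranslate (C : Pred 𝓛 0ℓ) (η : Carrier) (p : 𝓛) : Set where
      field
        p-invertible : Invertible p
        ⇒𝓗           : ∀ {f} → f ∈ C → ∃[ φ ] In𝓗 η φ × f ≡ φ ∘ᴸ p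
        𝓗⇒           : ∀ {φ} → In𝓗 η φ → φ ∘ᴸ p ∈ C

    -- From an equivalence to a right translate

    module _ {C : Pred 𝓛 0ℓ} (C-subspace : IsSubspace U C) {η : Carrier} (η≢0 : η ≢ 0#)
             (C≃𝓗 : Equivalence C (𝓗 k s η)) where
      open Equivalence C≃𝓗

      private
        h⁻¹ : 𝓛
        h⁻¹ = proj₁ h-invertible

        conjugate : Carrier → 𝓛
        conjugate a = h ∘ᴸ monomial a 0 ∘ᴸ h⁻¹

        -- A word of `𝓗` is the transform of some `f` in `C`. Left composition with the conjugate of
        -- `a` corresponds to scaling `f` by `from a`, which `σ` turns back into `a`, and `C` is
        -- closed under scaling.
        conjugate-idealises : ∀ a {φ} → In𝓗 η φ → In𝓗 η (conjugate a ∘ᴸ φ)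
        conjugate-idealises a {φ} φ∈ = 𝓗⇒In𝓗 (subst (𝓗 k s η)
          (sym (trans (cong (conjugate a ∘ᴸ_) (proj₂ (proj₂ source))) eq))
          (image (IsSubspace.*-closed C-subspace {from a} _ (proj₁ (proj₂ source)))))
          where
          source : ∃[ f ] f ∈ C × φ ≡ transform f
          source = preimage (In𝓗⇒𝓗 φ∈)
          f : 𝓛
          f = proj₁ source
          rest : 𝓛
          rest = map to f ∘ᴸ g
          eq : conjugate a ∘ᴸ h ∘ᴸ rest ≡ transform (from a *ₗ f)
          eq = begin
            (h ∘ᴸ monomial a 0 ∘ᴸ h⁻¹) ∘ᴸ h ∘ᴸ rest       ≡⟨ ∘-assoc h (monomial a 0 ∘ᴸ h⁻¹) (h ∘ᴸ rest) ⟩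
            h ∘ᴸ (monomial a 0 ∘ᴸ h⁻¹) ∘ᴸ h ∘ᴸ rest       ≡⟨ cong (h ∘ᴸ_) (∘-assoc (monomial a 0) h⁻¹ (h ∘ᴸ rest)) ⟩
            h ∘ᴸ monomial a 0 ∘ᴸ h⁻¹ ∘ᴸ h ∘ᴸ rest
              ≡⟨ cong (λ f → h ∘ᴸ monomial a 0 ∘ᴸ f) (trans (sym (∘-assoc h⁻¹ h rest))
                   (trans (cong (_∘ᴸ rest) (proj₂ (proj₂ h-invertible))) (∘-identityˡ rest))) ⟩
            h ∘ᴸ monomial a 0 ∘ᴸ rest                     ≡⟨ cong (h ∘ᴸ_) (*ₗ-as-∘ a rest) ⟨
            h ∘ᴸ (a *ₗ rest)                              ≡⟨ cong (h ∘ᴸ_) (*ₗ-∘ a (map to f) g) ⟨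
            h ∘ᴸ (a *ₗ map to f) ∘ᴸ g                     ≡⟨ cong (λ b → h ∘ᴸ (b *ₗ map to f) ∘ᴸ g) (to∘from a) ⟨
            h ∘ᴸ (to (from a) *ₗ map to f) ∘ᴸ g
              ≡⟨ cong (λ f → h ∘ᴸ f ∘ᴸ g) (Endomorphism.map-*ₗ to-hom (from a) f) ⟨
            h ∘ᴸ map to (from a *ₗ f) ∘ᴸ g                ∎

        -- The conjugate of `a` is a scalar `b`, so `h ∘ a` equals `b ∘ h`; the claim compares the
        -- coefficients of the two sides.
        h-semilinear : ∀ a → ∃[ b ] (∀ i → coef h i * a ^[ i ] ≡ b * coef h i)
        h-semilinear a = b , λ i → begin
          coef h i * a ^[ i ]                       ≡⟨ coef-∘-monomial h a 0 i ⟨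
          coef (h ∘ᴸ monomial a 0) (i ℕ.+ 0)        ≡⟨ cong (λ f → coef f (i ℕ.+ 0)) commutes ⟩
          coef (monomial b 0 ∘ᴸ h) (i ℕ.+ 0)        ≡⟨ coef-monomial-∘ b 0 h i ⟩
          b * coef h i ^[ 0 ]                       ≡⟨ cong (b *_) (frobenius-zero _) ⟩
          b * coef h i                              ∎
          where
          b : Carrier
          b = coef (conjugate a) 0
          commutes : h ∘ᴸ monomial a 0 ≡ monomial b 0 ∘ᴸ h
          commutes = begin
            h ∘ᴸ monomial a 0                       ≡⟨ cong (h ∘ᴸ_) (∘-identityʳ (monomial a 0)) ⟨
            h ∘ᴸ monomial a 0 ∘ᴸ x^[ 0 ]
              ≡⟨ cong (λ f → h ∘ᴸ monomial a 0 ∘ᴸ f) (proj₂ (proj₂ h-invertible)) ⟨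
            h ∘ᴸ monomial a 0 ∘ᴸ h⁻¹ ∘ᴸ h           ≡⟨ cong (h ∘ᴸ_) (∘-assoc (monomial a 0) h⁻¹ h) ⟨
            h ∘ᴸ (monomial a 0 ∘ᴸ h⁻¹) ∘ᴸ h         ≡⟨ ∘-assoc h (monomial a 0 ∘ᴸ h⁻¹) h ⟨
            conjugate a ∘ᴸ h
              ≡⟨ cong (_∘ᴸ h) (LeftIdealiser.idealiser-scalar 2<k k+2≤n η≢0 (conjugate a) (conjugate-idealises a)) ⟩
            monomial b 0 ∘ᴸ h                       ∎

      module Monomial {c c⁻¹ : Carrier} {i : ℕ} (cc⁻¹≡1 : c * c⁻¹ ≡ 1#) (h≡cxⁱ : h ≡ monomial c i) where
        α ρ : Automorphism
        α = frobenius-automorphism i ⊙ σ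
        module A = Automorphism α
        ρ = record { to = A.from ; from = A.to ; to-hom = A.from-hom ; from-hom = A.to-hom
                   ; to∘from = A.from∘to ; from∘to = A.to∘from }
        g′ : 𝓛
        g′ = x^[ i ] ∘ᴸ g
        g′-invertible : Invertible g′
        g′-invertible = ∘-invertible x^[ i ] g (x^-invertible i) g-invertible
        g′⁻¹ p : 𝓛
        g′⁻¹ = proj₁ g′-invertible
        p = map A.from g′⁻¹

        -- With `h` a monomial, its power of `x` splits into a Frobenius twist, merged with `σ` into
        -- `α`, and a factor of `g′`. What remains is the scalar `c`, harmless because `𝓗` is closed
        -- under scaling.
        transform≡ : ∀ f → transform f ≡ c *ₗ (map A.to f ∘ᴸ g′)
        transform≡ f = begin
          h ∘ᴸ map to f ∘ᴸ g                              ≡⟨ cong (_∘ᴸ map to f ∘ᴸ g) h≡cxⁱ ⟩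
          monomial c i ∘ᴸ map to f ∘ᴸ g
            ≡⟨ cong (_∘ᴸ map to f ∘ᴸ g) (trans (*ₗ-monomial c 1# i) (cong (λ a → monomial a i) (*-identityʳ c))) ⟨
          (c *ₗ x^[ i ]) ∘ᴸ map to f ∘ᴸ g                 ≡⟨ *ₗ-∘ c x^[ i ] (map to f ∘ᴸ g) ⟩
          c *ₗ (x^[ i ] ∘ᴸ map to f ∘ᴸ g)                 ≡⟨ cong (c *ₗ_) (∘-assoc x^[ i ] (map to f) g) ⟨
          c *ₗ ((x^[ i ] ∘ᴸ map to f) ∘ᴸ g)               ≡⟨ cong (λ f → c *ₗ (f ∘ᴸ g)) (x^-∘ i (map to f)) ⟩
          c *ₗ ((map (_^[ i ]) (map to f) ∘ᴸ x^[ i ]) ∘ᴸ g)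
            ≡⟨ cong (λ f → c *ₗ ((f ∘ᴸ x^[ i ]) ∘ᴸ g)) (Vec.map-∘ (_^[ i ]) to f) ⟨
          c *ₗ ((map A.to f ∘ᴸ x^[ i ]) ∘ᴸ g)             ≡⟨ cong (c *ₗ_) (∘-assoc (map A.to f) x^[ i ] g) ⟩
          c *ₗ (map A.to f ∘ᴸ g′)                         ∎

        c⁻¹-c : ∀ f → c⁻¹ *ₗ (c *ₗ f) ≡ f
        c⁻¹-c f = trans (*ₗ-*ₗ c⁻¹ c f) (trans (cong (_*ₗ f) (trans (*-comm c⁻¹ c) cc⁻¹≡1)) (1#-*ₗ f))

        normalised-∈ : ∀ {f} → f ∈ C → In𝓗 η (map A.to f ∘ᴸ g′)
        normalised-∈ {f} f∈C = subst (In𝓗 η) (trans (cong (c⁻¹ *ₗ_) (transform≡ f)) (c⁻¹-c _))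
          (In𝓗-*ₗ c⁻¹ (𝓗⇒In𝓗 (image f∈C)))

        f≡ : ∀ f → f ≡ map A.from (map A.to f ∘ᴸ g′) ∘ᴸ p
        f≡ f = begin
          f                                               ≡⟨ A.map-from∘to f ⟨
          map A.from (map A.to f)
            ≡⟨ cong (map A.from) (trans (sym (∘-identityʳ (map A.to f)))
                 (trans (cong (map A.to f ∘ᴸ_) (sym (proj₁ (proj₂ g′-invertible))))
                   (sym (∘-assoc (map A.to f) g′ g′⁻¹)))) ⟩
          map A.from ((map A.to f ∘ᴸ g′) ∘ᴸ g′⁻¹)         ≡⟨ Endomorphism.map-∘ A.from-hom (map A.to f ∘ᴸ g′) g′⁻¹ ⟩
          map A.from (map A.to f ∘ᴸ g′) ∘ᴸ p              ∎

        preimage-∘p : ∀ {ψ} → In𝓗 η (map A.to ψ) → ψ ∘ᴸ p ∈ C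
        preimage-∘p {ψ} ψ∈ = subst C (sym (begin
          ψ ∘ᴸ p                                          ≡⟨ cong (_∘ᴸ p) (A.map-from∘to ψ) ⟨
          map A.from (map A.to ψ) ∘ᴸ p
            ≡⟨ cong (λ φ → map A.from φ ∘ᴸ p) (trans (sym (c⁻¹-c (map A.to ψ)))
                 (trans (cong (c⁻¹ *ₗ_) (trans (proj₂ (proj₂ source)) (transform≡ f))) (c⁻¹-c (map A.to f ∘ᴸ g′)))) ⟩
          map A.from (map A.to f ∘ᴸ g′) ∘ᴸ p              ≡⟨ f≡ f ⟨
          f                                               ∎)) (proj₁ (proj₂ source))
          where
          -- The scaling by `c` anticipates the factor that `transform≡` produces, so that `c⁻¹` can
          -- cancel it.
          source : ∃[ f ] f ∈ C × c *ₗ map A.to ψ ≡ transform f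
          source = preimage (In𝓗⇒𝓗 (In𝓗-*ₗ c ψ∈))
          f : 𝓛
          f = proj₁ source

        isRightTranslate : IsRightTranslate C (A.from η) p
        isRightTranslate = record
          { p-invertible = map-invertible A.from-hom g′⁻¹ (inverse-invertible g′ g′-invertible)
          ; ⇒𝓗 = λ {f} f∈C → map A.from (map A.to f ∘ᴸ g′) , In𝓗-map A.from-hom (normalised-∈ f∈C) , f≡ f
          ; 𝓗⇒ = λ {ψ} ψ∈ → preimage-∘p (subst (λ ξ → In𝓗 ξ (map A.to ψ)) (A.to∘from η) (In𝓗-map A.to-hom ψ∈)) }

      rightTranslate : ∃[ ρ ] ∃[ p ] IsRightTranslate C (Automorphism.to ρ η) p
      rightTranslate =
        let c , i , c≢0 , h≡cxⁱ = semilinear⇒monomial h h-invertible h-semilinear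
            c⁻¹ , cc⁻¹≡1 = invertible c c≢0
            open Monomial cc⁻¹≡1 h≡cxⁱ
        in ρ , p , isRightTranslate

    -- Dimensions of the intersections of a translate with its shifts

    module _ {C : Pred 𝓛 0ℓ} {η : Carrier} {p : 𝓛} (η≢0 : η ≢ 0#) (C≡𝓗∘p : IsRightTranslate C η p) where
      open IsRightTranslate C≡𝓗∘p

      -- Shifting composes on the left and `p` acts on the right, so the two commute by
      -- associativity and the invertible `p` can be cancelled.
      shift⇒𝓗 : ∀ j {φ} → φ ∘ᴸ p ∈ (C ^ᶜ[ s ℕ.* j ]) → InShift η j φ
      shift⇒𝓗 j {φ} (f , f∈C , eq) =
        let ψ , ψ∈ , f≡ψp = ⇒𝓗 f∈C
        in shift⇒InShift (ψ , In𝓗⇒𝓗 ψ∈ , ∘-cancelʳ p p-invertible φ (x^[ s ℕ.* j ] ∘ᴸ ψ)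
             (trans eq (trans (cong (x^[ s ℕ.* j ] ∘ᴸ_) f≡ψp) (sym (∘-assoc x^[ s ℕ.* j ] ψ p)))))

      𝓗⇒shift : ∀ j {φ} → InShift η j φ → φ ∘ᴸ p ∈ (C ^ᶜ[ s ℕ.* j ])
      𝓗⇒shift j φ∈ =
        let ψ , ψ∈ , φ≡ = InShift⇒shift φ∈
        in ψ ∘ᴸ p , 𝓗⇒ (𝓗⇒In𝓗 ψ∈) , trans (cong (_∘ᴸ p) φ≡) (∘-assoc x^[ s ℕ.* j ] ψ p)

      private
        1+k<n : suc k < n
        1+k<n = subst (_≤ n) (ℕ.+-comm k 2) k+2≤n

      -- Zeros from `k` up to `n + a` leave the places `a`, ..., `k - 1` free, which are `d` in
      -- number. Composition with the invertible `p` preserves independence and spanning.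
      hasDim-translate : ∀ {V : Pred 𝓛 0ℓ} a d → a ℕ.+ d ≡ k →
        (∀ {f} → f ∈ V → ∃[ φ ] Zeros φ k (n ℕ.+ a) × f ≡ φ ∘ᴸ p) →
        (∀ {φ} → Zeros φ k (n ℕ.+ a) → φ ∘ᴸ p ∈ V) → HasDim U V d
      hasDim-translate {V} a d a+d≡k V⇒ ⇒V = (λ j → consecutive a d j ∘ᴸ p) , independent , V⊆span , span⊆V
        where
        d≤n : d ≤ n
        d≤n = ℕ.≤-trans (ℕ.m≤n+m d a) (ℕ.≤-trans (ℕ.≤-reflexive a+d≡k) (ℕ.<⇒≤ k<n))
        independent : LinearlyIndependent U (λ j → consecutive a d j ∘ᴸ p)
        independent c _ eq = consecutive-independent d≤n c _
          (∘-cancelʳ p p-invertible (combination c (consecutive a d)) 0ᴹ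
            (trans (combination-∘ c (consecutive a d) p) (trans eq (sym (Additive.0ᴹ-homo (∘-additiveˡ p))))))
        V⊆span : ∀ {f} → f ∈ V → Span U (λ j → consecutive a d j ∘ᴸ p) f
        V⊆span f∈V =
          let φ , φ-zeros , f≡φp = V⇒ f∈V
              c , _ , φ≡ = zeros⇒span {a} d≤n (subst (λ m → Zeros φ m (n ℕ.+ a)) (sym a+d≡k) φ-zeros)
          in c , _ , trans f≡φp (trans (cong (_∘ᴸ p) φ≡) (combination-∘ c (consecutive a d) p))
        span⊆V : ∀ {f} → Span U (λ j → consecutive a d j ∘ᴸ p) f → f ∈ V
        span⊆V (c , _ , f≡) = subst V (trans (combination-∘ c (consecutive a d) p) (sym f≡))
          (⇒V (subst (λ m → Zeros (combination c (consecutive a d)) m (n ℕ.+ a)) a+d≡k (consecutive-zeros d≤n c)))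

      -- `zeros-base` disposes of the coefficient at 0 and `zeros-step` of the one at 1. These are
      -- the two dimensions lost.
      translate-zeros : ∀ {f} → f ∈ C ∩ (C ^ᶜ[ s ]) → ∃[ φ ] Zeros φ k (n ℕ.+ 2) × f ≡ φ ∘ᴸ p
      translate-zeros (f∈C , f∈Cˢ) =
        let φ , φ∈ , f≡φp = ⇒𝓗 f∈C
            φ∈₁ = shift⇒𝓗 1 (subst₂ (λ g m → g ∈ (C ^ᶜ[ m ])) f≡φp (sym (ℕ.*-identityʳ s)) f∈Cˢ)
        in φ , subst (Zeros φ k) (sym (ℕ.+-suc n 1)) (zeros-step η≢0 φ∈₁ (zeros-base 1+k<n φ∈ φ∈₁)) , f≡φp

      zeros-translate : ∀ {a φ} → 1 < a → Zeros φ k (n ℕ.+ a) → φ ∘ᴸ p ∈ C ∩ (C ^ᶜ[ s ])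
      zeros-translate {a} {φ} 1<a φ-zeros = 𝓗⇒ (zeros⇒In𝓗 (ℕ.<-trans (s≤s z≤n) 1<a) φ-zeros) ,
        subst (λ m → φ ∘ᴸ p ∈ (C ^ᶜ[ m ])) (ℕ.*-identityʳ s) (𝓗⇒shift 1 (zeros⇒InShift 1<a φ-zeros))

      dim-∩ : ∀ d → 2 ℕ.+ d ≡ k → HasDim U (C ∩ (C ^ᶜ[ s ])) d
      dim-∩ d eq = hasDim-translate 2 d eq translate-zeros (zeros-translate ℕ.≤-refl)

      dim-∩-∩ : ∀ d → 3 ℕ.+ d ≡ k → HasDim U (C ∩ (C ^ᶜ[ s ]) ∩ (C ^ᶜ[ 2 ℕ.* s ])) d
      dim-∩-∩ d eq = hasDim-translate 3 d eq
        (λ (f∈C , f∈Cˢ , f∈C²ˢ) →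
          let φ , φ-zeros , f≡φp = translate-zeros (f∈C , f∈Cˢ)
              φ∈₂ = shift⇒𝓗 2 (subst₂ (λ g m → g ∈ (C ^ᶜ[ m ])) f≡φp (ℕ.*-comm 2 s) f∈C²ˢ)
          in φ , subst (Zeros φ k) (sym (ℕ.+-suc n 2)) (zeros-step η≢0 φ∈₂ φ-zeros) , f≡φp)
        λ {φ} φ-zeros →
          let f∈C , f∈Cˢ = zeros-translate (s≤s (s≤s z≤n)) φ-zeros
          in f∈C , f∈Cˢ , subst (λ m → φ ∘ᴸ p ∈ (C ^ᶜ[ m ])) (ℕ.*-comm s 2)
               (𝓗⇒shift 2 (zeros⇒InShift ℕ.≤-refl φ-zeros))

    -- The direct sum decomposition and right translates

    powers-combination : ∀ p c → combination c (powers p s k) ≡ combination c (consecutive 1 k-1) ∘ᴸ p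
    powers-combination p c = sym (combination-∘ c (consecutive 1 k-1) p)

    twisted : Carrier → 𝓛 → 𝓛
    twisted η p = p +ᴹ (η *ₗ (p ^ᴸ[ s ℕ.* k ]))

    twisted≡ : ∀ η p → twisted η p ≡ 𝓗-generators k s η zero ∘ᴸ p
    twisted≡ η p = sym (trans (Additive.+ᴹ-homo (∘-additiveˡ p) x^[ 0 ] (η *ₗ x^[ s ℕ.* k ]))
      (cong₂ _+ᴹ_ (∘-identityˡ p) (*ₗ-∘ η x^[ s ℕ.* k ] p)))

    𝓗-combination-∘ : ∀ η p c → combination c (𝓗-generators k s η) ∘ᴸ p ≡
                      combination (c ∘ suc) (powers p s k) +ᴹ c zero *ₗ twisted η p
    𝓗-combination-∘ η p c = begin
      combination c (𝓗-generators k s η) ∘ᴸ p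
        ≡⟨ Additive.+ᴹ-homo (∘-additiveˡ p) (c zero *ₗ 𝓗-generators k s η zero)
             (combination (c ∘ suc) (consecutive 1 k-1)) ⟩
      (c zero *ₗ 𝓗-generators k s η zero) ∘ᴸ p +ᴹ combination (c ∘ suc) (consecutive 1 k-1) ∘ᴸ p
        ≡⟨ cong₂ _+ᴹ_ (trans (*ₗ-∘ (c zero) (𝓗-generators k s η zero) p) (cong (c zero *ₗ_) (sym (twisted≡ η p))))
             (sym (powers-combination p (c ∘ suc))) ⟩
      c zero *ₗ twisted η p +ᴹ combination (c ∘ suc) (powers p s k)
        ≡⟨ Vec.zipWith-comm +-comm (c zero *ₗ twisted η p) _ ⟩
      combination (c ∘ suc) (powers p s k) +ᴹ c zero *ₗ twisted η p ∎

    singleton-combination : ∀ (c : Fin 1 → Carrier) r → combination c (λ _ → r) ≡ c zero *ₗ r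
    singleton-combination c r = +ᴹ-identityʳ (c zero *ₗ r)

    -- The coefficient of x separates the twisted generator from the others.
    twisted-independent : ∀ {η p} → Invertible p → ∀ a c →
      combination c (powers p s k) ≡ a *ₗ twisted η p → a ≡ 0#
    twisted-independent {η} {p} p-inv a c eq = sym (begin
      0#
        ≡⟨ consecutive-zeros {1} k-1≤n c n (ℕ.<⇒≤ k<n) (subst (n <_) (ℕ.+-comm 1 n) ℕ.≤-refl) ⟨
      coefˢ (combination c (consecutive 1 k-1)) n
        ≡⟨ cong (λ f → coefˢ f n) (∘-cancelʳ p p-inv (combination c (consecutive 1 k-1))
             (a *ₗ 𝓗-generators k s η zero)
             (trans (sym (powers-combination p c)) (trans eq
               (trans (cong (a *ₗ_) (twisted≡ η p)) (sym (*ₗ-∘ a (𝓗-generators k s η zero) p)))))) ⟩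
      coefˢ (a *ₗ 𝓗-generators k s η zero) n
        ≡⟨ trans (cong (coefˢ _) (sym (ℕ.+-identityʳ n))) (coefˢ-+n _ 0) ⟩
      coefˢ (a *ₗ 𝓗-generators k s η zero) 0
        ≡⟨ coef-*ₗ a _ _ ⟩
      a * coefˢ (𝓗-generators k s η zero) 0
        ≡⟨ cong (a *_) (head-coefˢ-0 η) ⟩
      a * 1#
        ≡⟨ *-identityʳ a ⟩
      a ∎)
      where
      k-1≤n : k-1 ≤ n
      k-1≤n = ℕ.≤-trans (ℕ.n≤1+n _) (ℕ.<⇒≤ k<n)

    -- The powers of `p` are the untwisted generators composed with `p`, so the twisted generator
    -- itself spans a complement; `twisted-independent` makes the sum direct.
    translate-directSum : ∀ {C η p} → IsRightTranslate C η p →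
      IsDirectSum C (Span U (powers p s k)) (Span {1} U (λ _ → twisted η p))
    translate-directSum {C} {η} {p} C≡𝓗∘p = record
      { sum-≐ = split , λ (_ , _ , (c , _ , a≡) , (c′ , _ , b≡) , f≡a+b) →
          subst C (sym (trans f≡a+b (cong₂ _+ᴹ_ a≡ b≡))) (join c c′)
      ; intersection = λ v (c , _ , v≡) (c′ , _ , v≡′) →
          let v≡bt = trans v≡′ (singleton-combination c′ (twisted η p))
          in trans v≡bt (trans (cong (_*ₗ twisted η p)
               (twisted-independent {η} p-invertible (c′ zero) c (trans (sym v≡) v≡bt))) (0#-*ₗ (twisted η p))) }
      where
      open IsRightTranslate C≡𝓗∘p
      split : ∀ {f} → f ∈ C → ∃[ a ] ∃[ b ] Span U (powers p s k) a × Span {1} U (λ _ → twisted η p) b × f ≡ a +ᴹ b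
      split f∈C =
        let φ , φ∈ , f≡φp = ⇒𝓗 f∈C
            c , _ , φ≡ = In𝓗⇒𝓗 φ∈
        in _ , _ , (c ∘ suc , _ , refl) , ((λ _ → c zero) , _ , refl) ,
           trans f≡φp (trans (cong (_∘ᴸ p) φ≡) (trans (𝓗-combination-∘ η p c)
             (cong (combination (c ∘ suc) (powers p s k) +ᴹ_)
               (sym (singleton-combination (λ _ → c zero) (twisted η p))))))
      join : ∀ c (c′ : Fin 1 → Carrier) → combination c (powers p s k) +ᴹ combination c′ (λ _ → twisted η p) ∈ C
      join c c′ = subst C (trans (𝓗-combination-∘ η p c″) (cong (combination c (powers p s k) +ᴹ_)
          (sym (singleton-combination c′ (twisted η p)))))
        (𝓗⇒ (𝓗⇒In𝓗 (c″ , _ , refl)))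
        where
        c″ : Fin k → Carrier
        c″ zero    = c′ zero
        c″ (suc j) = c j

    twisted∈translate : ∀ {C η p} → IsRightTranslate C η p → twisted η p ∈ C
    twisted∈translate {C} {η} {p} C≡𝓗∘p = subst C (sym (twisted≡ η p))
      (𝓗⇒ (in𝓗 (trans (head-coefˢ-k η) (sym (trans (cong (η *_) (head-coefˢ-0 η)) (*-identityʳ η))))
        λ i k<i i<n → head-coefˢ-off η i<n (λ { refl → case k<i of λ () }) (ℕ.<⇒≢ k<i ∘ sym)))
      where open IsRightTranslate C≡𝓗∘p

    directSum⇒translate : ∀ {C η p r} → IsSubspace U C → r ∈ C → Invertible p →
      IsDirectSum C (Span U (powers p s k)) (Span {1} U (λ _ → r)) → twisted η p ∈ C → IsRightTranslate C η p
    directSum⇒translate {C} {η} {p} {r} C-subspace r∈C p-inv C-sum twisted∈C = record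
      { p-invertible = p-inv
      ; ⇒𝓗 = λ f∈C →
          let _ , _ , (c , _ , a≡) , (c′ , _ , b≡) , f≡a+b = proj₁ sum-≐ f∈C
              φ , φ∈ , eq = C⇒𝓗 c c′
          in φ , φ∈ , trans f≡a+b (trans (cong₂ _+ᴹ_ a≡ b≡) eq)
      ; 𝓗⇒ = λ φ∈ →
          let c , _ , φ≡ = In𝓗⇒𝓗 φ∈
          in subst C (sym (trans (cong (_∘ᴸ p) φ≡) (𝓗-combination-∘ η p c)))
               (+-closed (powers∈C (c ∘ suc)) (*-closed _ twisted∈C)) }
      where
      open IsDirectSum C-sum
      open IsSubspace C-subspace
      powers∈C : ∀ c → combination c (powers p s k) ∈ C
      powers∈C c = proj₂ sum-≐ (_ , 0ᴹ , (c , _ , refl) ,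
        ((λ _ → 0#) , _ , sym (trans (singleton-combination (λ _ → 0#) r) (0#-*ₗ r))) , sym (+ᴹ-identityʳ _))
      -- This is `𝓗 ∘ p`, described by coordinates along the generators so that its closure under
      -- addition and scaling is immediate.
      Image : Pred 𝓛 0ℓ
      Image f = ∃[ c ] f ≡ combination c (𝓗-generators k s η) ∘ᴸ p
      image-+ : ∀ {f g} → f ∈ Image → g ∈ Image → f +ᴹ g ∈ Image
      image-+ (c , f≡) (c′ , g≡) = (λ i → c i + c′ i) , trans (cong₂ _+ᴹ_ f≡ g≡)
        (trans (sym (Additive.+ᴹ-homo (∘-additiveˡ p) (combination c (𝓗-generators k s η))
                 (combination c′ (𝓗-generators k s η))))
          (cong (_∘ᴸ p) (sym (combination-+ c c′ (𝓗-generators k s η)))))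
      image-*ₗ : ∀ a {f} → f ∈ Image → a *ₗ f ∈ Image
      image-*ₗ a (c , f≡) = (λ i → a * c i) , trans (cong (a *ₗ_) f≡)
        (trans (sym (*ₗ-∘ a (combination c (𝓗-generators k s η)) p))
          (cong (_∘ᴸ p) (*ₗ-combination a c (𝓗-generators k s η))))
      image-combine : ∀ c a → combination c (powers p s k) +ᴹ a *ₗ twisted η p ∈ Image
      image-combine c a = c″ , sym (𝓗-combination-∘ η p c″)
        where
        c″ : Fin k → Carrier
        c″ zero    = a
        c″ (suc j) = c j
      image-powers : ∀ c → combination c (powers p s k) ∈ Image
      image-powers c = subst Image
        (trans (cong (combination c (powers p s k) +ᴹ_) (0#-*ₗ (twisted η p))) (+ᴹ-identityʳ _))
        (image-combine c 0#)
      -- Since twisted η p is not a combination of the powers, its component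
      -- along r is nonzero, so r can be solved for.
      r∈Image : r ∈ Image
      r∈Image =
        let _ , _ , (e , _ , a≡) , (e′ , _ , b≡) , eq = proj₁ sum-≐ twisted∈C
        in solve e (e′ zero) (trans eq (cong₂ _+ᴹ_ a≡ (trans b≡ (singleton-combination e′ r))))
        where
        solve : ∀ e b → twisted η p ≡ combination e (powers p s k) +ᴹ b *ₗ r → r ∈ Image
        solve e b eq with b ≟ᶠ 0#
        ... | yes b≡0 = contradiction (sym (twisted-independent {η} p-inv 1# e
                (sym (trans (1#-*ₗ (twisted η p)) (trans eq (trans
                  (cong (λ a → combination e (powers p s k) +ᴹ a *ₗ r) b≡0) (trans
                  (cong (combination e (powers p s k) +ᴹ_) (0#-*ₗ r)) (+ᴹ-identityʳ _)))))))) 0≢1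
        ... | no b≢0 = subst Image (begin
                b⁻¹ *ₗ (E⁻ +ᴹ 1# *ₗ twisted η p)
                  ≡⟨ cong (λ f → b⁻¹ *ₗ (E⁻ +ᴹ f)) (trans (1#-*ₗ (twisted η p)) eq) ⟩
                b⁻¹ *ₗ (E⁻ +ᴹ (E +ᴹ b *ₗ r))
                  ≡⟨ cong (b⁻¹ *ₗ_) (Vec.zipWith-assoc +-assoc E⁻ E (b *ₗ r)) ⟨
                b⁻¹ *ₗ ((E⁻ +ᴹ E) +ᴹ b *ₗ r)
                  ≡⟨ cong (λ f → b⁻¹ *ₗ (f +ᴹ b *ₗ r)) (trans (sym (combination-+ (λ i → - e i) e (powers p s k)))
                       (combination-zero _ (powers p s k) (λ i → -‿inverseˡ (e i)))) ⟩
                b⁻¹ *ₗ (0ᴹ +ᴹ b *ₗ r)        ≡⟨ cong (b⁻¹ *ₗ_) (+ᴹ-identityˡ (b *ₗ r)) ⟩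
                b⁻¹ *ₗ (b *ₗ r)              ≡⟨ *ₗ-*ₗ b⁻¹ b r ⟩
                (b⁻¹ * b) *ₗ r
                  ≡⟨ cong (_*ₗ r) (trans (*-comm b⁻¹ b) (proj₂ (invertible b b≢0))) ⟩
                1# *ₗ r                      ≡⟨ 1#-*ₗ r ⟩
                r                            ∎)
                (image-*ₗ b⁻¹ (image-combine (λ i → - e i) 1#))
          where
          b⁻¹ : Carrier
          b⁻¹ = proj₁ (invertible b b≢0)
          E E⁻ : 𝓛
          E = combination e (powers p s k)
          E⁻ = combination (λ i → - e i) (powers p s k)
      C⇒𝓗 : ∀ c c′ → ∃[ φ ] In𝓗 η φ × combination c (powers p s k) +ᴹ combination {1} c′ (λ _ → r) ≡ φ ∘ᴸ p
      C⇒𝓗 c c′ =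
        let d , eq = image-+ (image-powers c)
                       (subst Image (sym (singleton-combination c′ r)) (image-*ₗ (c′ zero) r∈Image))
        in combination d (𝓗-generators k s η) , 𝓗⇒In𝓗 (d , _ , refl) , eq

    translate⇒equivalent : ∀ {C η p} → IsRightTranslate C η p → Equivalent C (𝓗 k s η)
    translate⇒equivalent {C} {η} {p} C≡𝓗∘p =
      x^[ 0 ] , p⁻¹ , id , x^[0]-invertible , inverse-invertible p p-invertible ,
      Identity.isRingIsomorphism rawRing refl ,
      (λ (f , f∈C , ψ≡) →
        let φ , φ∈ , f≡φp = ⇒𝓗 f∈C
        in subst (𝓗 k s η) (sym (trans ψ≡ (trans (cong (λ f → x^[ 0 ] ∘ᴸ map id f ∘ᴸ p⁻¹) f≡φp) (untranslate φ))))
             (In𝓗⇒𝓗 φ∈)) ,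
      λ {φ} φ∈ → φ ∘ᴸ p , 𝓗⇒ (𝓗⇒In𝓗 φ∈) , sym (untranslate φ)
      where
      open IsRightTranslate C≡𝓗∘p
      p⁻¹ : 𝓛
      p⁻¹ = proj₁ p-invertible
      untranslate : ∀ φ → x^[ 0 ] ∘ᴸ map id (φ ∘ᴸ p) ∘ᴸ p⁻¹ ≡ φ
      untranslate φ = begin
        x^[ 0 ] ∘ᴸ map id (φ ∘ᴸ p) ∘ᴸ p⁻¹     ≡⟨ ∘-identityˡ _ ⟩
        map id (φ ∘ᴸ p) ∘ᴸ p⁻¹                ≡⟨ cong (_∘ᴸ p⁻¹) (Vec.map-id (φ ∘ᴸ p)) ⟩
        (φ ∘ᴸ p) ∘ᴸ p⁻¹                       ≡⟨ ∘-assoc φ p p⁻¹ ⟩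
        φ ∘ᴸ p ∘ᴸ p⁻¹                         ≡⟨ cong (φ ∘ᴸ_) (proj₁ (proj₂ p-invertible)) ⟩
        φ ∘ᴸ x^[ 0 ]                          ≡⟨ ∘-identityʳ φ ⟩
        φ                                     ∎

-- Characterisation of the codes equivalent to generalized twisted Gabidulin codes

theorem3p9 : (q n : ℕ) .{{_ : NonZero n}} → IsPrimePower q →
    (F : FiniteField (q ℕ.^ n)) →
    let open RankMetric q n F in
    (C : Pred 𝓛 0ℓ) (k : ℕ) →
    IsSubspace U C → HasDim U C k → IsMRD C →
    2 < k → k ℕ.+ 2 ≤ n →
    (∃[ D ] IsGTGabidulin D × Equivalent C D)
    ⇔
    (∃[ s ] gcd s n ≡ 1 ×
    HasDim U (C ∩ (C ^ᶜ[ s ])) (k ∸ 2) ×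
    HasDim U (C ∩ (C ^ᶜ[ s ]) ∩ (C ^ᶜ[ 2 ℕ.* s ])) (k ∸ 3) ×
    (∃[ p ] ∃[ r ] r ∈ C ×
    IsDirectSum C (Span U (powers p s k)) (Span {1} U (λ _ → r)) ×
    Invertible p ×
    (∃[ η ] η ≢ 0# × AdmissibleNorm k η ×
    p +ᴹ (η *ₗ (p ^ᴸ[ s ℕ.* k ])) ∈ C)))
theorem3p9 q n q-primePower F C zero C-subspace C-dim _ () k+2≤n
theorem3p9 q n q-primePower F C (suc zero) C-subspace C-dim _ (s≤s ()) k+2≤n
theorem3p9 q n q-primePower F C (suc (suc zero)) C-subspace C-dim _ (s≤s (s≤s ())) k+2≤n
-- With three successors exposed, `k ∸ 2` and `k ∸ 3` compute to `suc k-3` and `k-3`, the dimensions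
-- that `dim-∩` and `dim-∩-∩` deliver.
theorem3p9 q n q-primePower F C k@(suc (suc (suc k-3))) C-subspace C-dim _ 2<k k+2≤n = mk⇔ to from
  where
  open LinearizedPolynomials q n q-primePower F
  open Codes q n q-primePower F
  open TwistedGabidulinCodes q n q-primePower F

  1≤k : 1 ≤ k
  1≤k = s≤s z≤n

  k≤n : k ≤ n
  k≤n = ℕ.≤-trans (ℕ.m≤m+n k 2) k+2≤n

  Condition : ℕ → Set
  Condition s = gcd s n ≡ 1 ×
    HasDim U (C ∩ (C ^ᶜ[ s ])) (k ∸ 2) ×
    HasDim U (C ∩ (C ^ᶜ[ s ]) ∩ (C ^ᶜ[ 2 ℕ.* s ])) (k ∸ 3) ×
    (∃[ p ] ∃[ r ] r ∈ C ×
    IsDirectSum C (Span U (powers p s k)) (Span {1} U (λ _ → r)) ×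
    Invertible p ×
    (∃[ η ] η ≢ 0# × AdmissibleNorm k η ×
    p +ᴹ (η *ₗ (p ^ᴸ[ s ℕ.* k ])) ∈ C))

  translate⇒condition : ∀ {s η p} (gcd≡1 : gcd s n ≡ 1) → η ≢ 0# → AdmissibleNorm k η →
    IsRightTranslate s gcd≡1 2<k k+2≤n C η p → Condition s
  translate⇒condition {s} {η} {p} gcd≡1 η≢0 admissible C≡𝓗∘p = gcd≡1 ,
    dim-∩ s gcd≡1 2<k k+2≤n η≢0 C≡𝓗∘p (suc k-3) refl ,
    dim-∩-∩ s gcd≡1 2<k k+2≤n η≢0 C≡𝓗∘p k-3 refl ,
    p , twisted s gcd≡1 2<k k+2≤n η p , twisted∈C , translate-directSum s gcd≡1 2<k k+2≤n C≡𝓗∘p ,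
    IsRightTranslate.p-invertible C≡𝓗∘p , η , η≢0 , admissible , twisted∈C
    where
    twisted∈C = twisted∈translate s gcd≡1 2<k k+2≤n C≡𝓗∘p

  -- The equality of parameters is an argument so that matching on it replaces `k′` by `k` in the
  -- norm condition and in the equivalence at once.
  gabidulin⇒condition : ∀ {k′ s η} → k′ ≡ k → gcd s n ≡ 1 → η ≢ 0# → AdmissibleNorm k′ η →
    Equivalence C (𝓗 k′ s η) → ∃[ s ] Condition s
  gabidulin⇒condition {s = s} {η} refl gcd≡1 η≢0 admissible C≃𝓗 =
    -- Absorbing `h` and `σ` changes `η` to its image under `ρ`, so nonvanishing and admissibility
    -- have to be carried along `ρ`.
    let ρ , p , C≡𝓗∘p = rightTranslate s gcd≡1 2<k k+2≤n C-subspace η≢0 C≃𝓗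
        open Automorphism ρ
    in s , translate⇒condition gcd≡1
      (λ ρη≡0 → η≢0 (trans (sym (from∘to η)) (trans (cong from ρη≡0) (Endomorphism.0-homo from-hom))))
      (admissible-automorphism ρ k admissible) C≡𝓗∘p

  to : (∃[ D ] IsGTGabidulin D × Equivalent C D) → ∃[ s ] Condition s
  to (D , (k′ , s , η , 1≤k′ , k′≤n , gcd≡1 , η≢0 , admissible , D≃𝓗) , C≃D) =
    gabidulin⇒condition (𝓗-dimension C-dim k+2≤n gcd≡1 1≤k′ k′≤n C≃𝓗) gcd≡1 η≢0 admissible C≃𝓗
    where
    C≃𝓗 : Equivalence C (𝓗 k′ s η)
    C≃𝓗 = equivalence-trans (equivalence C≃D) (equivalence D≃𝓗)

  from : (∃[ s ] Condition s) → ∃[ D ] IsGTGabidulin D × Equivalent C D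
  from (s , gcd≡1 , _ , _ , p , r , r∈C , C-sum , p-inv , η , η≢0 , admissible , twisted∈C) =
    𝓗 k s η ,
    (k , s , η , 1≤k , k≤n , gcd≡1 , η≢0 , admissible , equivalent-refl (𝓗 k s η)) ,
    translate⇒equivalent s gcd≡1 2<k k+2≤n
      (directSum⇒translate s gcd≡1 2<k k+2≤n C-subspace r∈C p-inv C-sum twisted∈C)
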